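{- Let $n \geq 3$ be an integer and let $\Phi_n(x)$ be the $n$th cyclotomic polynomial, which has even degree $\phi(n)$. Let $c_n$ denote the middle coefficient of $\Phi_n(x)$, i.e. the coefficient of $x^{\phi(n)/2}$ in $\Phi_n(x)$. If $n$ is a power of $2$, then $c_n = 0$; if $n$ is not a power of $2$, then $c_n$ is an odd integer.
   Context: $\phi$ is Euler's totient function. For a positive integer $n$, the $n$th cyclotomic polynomial is $\Phi_n(x) = \prod_{1 \le k \le n,\ \gcd(k,n)=1} \left(x - e^{2\pi i k/n}\right)$, a monic polynomial with integer coefficients of degree $\phi(n)$. For $n \geq 3$, $\phi(n)$ is even, and the middle coefficient of $\Phi_n(x)$ means the coefficient of $x^{\phi(n)/2}$. -}

module Defs where

open import Level using (Level; _⊔_)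
open import Algebra.Apartness.Bundles using (HeytingField; HeytingCommutativeRing)
open import Algebra.Bundles using (CommutativeRing; Semiring)
import Algebra.Definitions.RawSemiring as RawSemiringDefs
open import Data.Integer.Base as ℤ using (ℤ; +_; -[1+_])
open import Data.List.Base using (List; []; _∷_; map; foldr; filter; length; upTo)
open import Data.Nat.Base as ℕ using (ℕ; zero; suc; _≤_; _<_)
open import Data.Nat.GCD using (gcd)
import Data.Nat.Properties as ℕₚ
open import Data.Product.Base using (_×_; ∃-syntax)
open import Relation.Binary.PropositionalEquality using (_≡_)

-- The k with 1 ≤ k ≤ n and gcd(k,n) = 1.
totatives : ℕ → List ℕ
totatives n = filter (λ k → gcd k n ℕₚ.≟ 1) (map suc (upTo n))

φ : ℕ → ℕ
φ n = length (totatives n)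

IsPowerOf2 : ℕ → Set
IsPowerOf2 n = ∃[ k ] n ≡ 2 ℕ.^ k

OddInteger : ℤ → Set
OddInteger c = ∃[ k ] c ≡ + 2 ℤ.* k ℤ.+ + 1

-- HeytingField is the library's notion of field: distinctness is an apartness
-- x # y, equivalent to invertibility of x - y. For a field with decidable
-- equality it amounts to ¬ (x ≈ y); the complex numbers, classical or
-- constructive, form such a field with x # y meaning ∣x - y∣ > 0.
module OverField {a ℓ₁ ℓ₂ : Level} (K : HeytingField a ℓ₁ ℓ₂) where

  open HeytingField K using (Carrier; _≈_; _#_; _+_; _*_; -_; 0#; 1#)

  commutativeRing : CommutativeRing a ℓ₁
  commutativeRing =
    HeytingCommutativeRing.commutativeRing (HeytingField.heytingCommutativeRing K)

  open Semiring (CommutativeRing.semiring commutativeRing) using (rawSemiring)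
  open RawSemiringDefs rawSemiring using (_^_) renaming (_×_ to _·_)

  CharacteristicZero : Set ℓ₂
  CharacteristicZero = ∀ m → (suc m · 1#) # 0#

  fromℤ : ℤ → Carrier
  fromℤ (+ m)    = m · 1#
  fromℤ -[1+ m ] = - (suc m · 1#)

  -- In the complex numbers, e^(2πi/n) is such a ζ.
  IsPrimitiveRoot : ℕ → Carrier → Set (ℓ₁ ⊔ ℓ₂)
  IsPrimitiveRoot n ζ = (ζ ^ n ≈ 1#) × (∀ k → 1 ≤ k → k < n → (ζ ^ k) # 1#)

  -- Coefficient lists, constant term first; trailing zeros are allowed.
  Poly : Set a
  Poly = List Carrier

  coeff : Poly → ℕ → Carrier
  coeff []      _       = 0#
  coeff (c ∷ _) zero    = c
  coeff (_ ∷ p) (suc i) = coeff p i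

  infixl 6 _+ᵖ_
  infixl 7 _*ᵖ_

  _+ᵖ_ : Poly → Poly → Poly
  []      +ᵖ q       = q
  (c ∷ p) +ᵖ []      = c ∷ p
  (c ∷ p) +ᵖ (d ∷ q) = (c + d) ∷ (p +ᵖ q)

  _*ᵖ_ : Poly → Poly → Poly
  []      *ᵖ q = []
  (c ∷ p) *ᵖ q = map (c *_) q +ᵖ (0# ∷ (p *ᵖ q))

  ∏ᵖ : List Poly → Poly
  ∏ᵖ = foldr _*ᵖ_ (1# ∷ [])

  X-_ : Carrier → Poly
  X- r = - r ∷ 1# ∷ []

  -- For ζ = e^(2πi/n): the product of X - e^(2πik/n) over the k ≤ n prime to n.
  cyclotomic : ℕ → Carrier → Poly
  cyclotomic n ζ = ∏ᵖ (map (λ k → X- (ζ ^ k)) (totatives n))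

  middleCoefficient : ℕ → Carrier → Carrier
  middleCoefficient n ζ = coeff (cyclotomic n ζ) (φ n ℕ./ 2)

{-# OPTIONS --safe #-}
module Submission where

open import Defs
open import Algebra.Apartness.Bundles using (HeytingField)
open import Algebra.Bundles using (CommutativeRing)
import Algebra.Properties.AbelianGroup as AbelianGroupProperties
import Algebra.Properties.CommutativeSemigroup as CommutativeSemigroupProperties
import Algebra.Properties.CommutativeSemiring.Exp as Exp
import Algebra.Properties.Group as GroupProperties
import Algebra.Properties.Ring as RingProperties
import Algebra.Properties.Semiring.Mult as Mult
import Algebra.Solver.Ring as RingSolver
open import Algebra.Solver.Ring.AlmostCommutativeRing
  using (fromCommutativeRing; _-Raw-AlmostCommutative⟶_)
open import Data.Integer.Base as ℤ using (ℤ; +_; -[1+_]; _⊖_)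
open import Data.Integer.Divisibility.Signed as Signed using () renaming (_∣_ to _∣ℤ_)
import Data.Integer.DivMod as ℤDivMod
import Data.Integer.Properties as ℤₚ
open import Data.List.Base
  using (List; []; _∷_; [_]; _++_; map; foldr; filter; length; upTo; applyUpTo; reverse; replicate; take; drop)
import Data.List.Properties as Listₚ
open import Data.List.Membership.Propositional using (_∈_)
import Data.List.Membership.Propositional.Properties as ∈ₚ
open import Data.List.Membership.Propositional.Properties.WithK using (unique∧set⇒bag)
open import Data.List.Relation.Binary.BagAndSetEquality using (∼bag⇒↭)
open import Data.List.Relation.Binary.Permutation.Propositional as Perm using (_↭_)
open import Data.List.Relation.Binary.Pointwise as Pointwise using (Pointwise; []; _∷_)
open import Data.List.Relation.Unary.All as All using (All; []; _∷_)
import Data.List.Relation.Unary.All.Properties as Allₚ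
open import Data.List.Relation.Unary.AllPairs using (AllPairs; []; _∷_)
import Data.List.Relation.Unary.AllPairs.Properties as AllPairsₚ
open import Data.List.Relation.Unary.Any using (here; there)
open import Data.List.Relation.Unary.Unique.Propositional using (Unique)
import Data.List.Relation.Unary.Unique.Propositional.Properties as Uniqueₚ
import Data.Maybe.Base as Maybe
open import Data.Nat.Base as ℕ using (ℕ; zero; suc; _≤_; _<_; _≥_; z≤n; s≤s; NonZero)
open import Data.Nat.Coprimality using (Coprime; coprime-divisor; coprime⇒gcd≡1; gcd≡1⇒coprime)
open import Data.Nat.Divisibility as Div using (_∣_; _∤_; _∣?_; divides)
import Data.Nat.DivMod as DivMod
open import Data.Nat.GCD as GCD using (gcd)
open import Data.Nat.Induction using (<-rec)
open import Data.Nat.Primality using (irreducible[2])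
import Data.Nat.Properties as ℕₚ
open import Data.Product.Base using (_×_; _,_; proj₁; proj₂; ∃-syntax)
open import Data.Sum.Base using (_⊎_; inj₁; inj₂)
open import Function.Base using (_∘_; id)
open import Function.Bundles using (mk⇔)
open import Level using (_⊔_)
open import Relation.Binary.PropositionalEquality as ≡ using (_≡_; _≢_)
open import Relation.Nullary using (¬_; yes; no; contradiction)
open import Relation.Nullary.Decidable using (¬?; dec⇒maybe)
open import Relation.Unary using (Pred; Decidable)

-- Φₙ is palindromic with integer coefficients, so its middle coefficient has the
-- parity of Φₙ(1). Write n = m 2ᵃ with m odd. If m > 1, then Φₙ(X) divides
-- (Xⁿ - 1) / (Y - 1) = 1 + Y + ⋯ + Yᵐ⁻¹ for Y = X^(2ᵃ), with an integral cofactor,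
-- so Φₙ(1) divides m and is odd. If m = 1, then Φₙ = X^(n/2) + 1.
-- Integrality follows by strong induction from Xⁿ - 1 = ∏_{d∣n} Φ_d. Identities between
-- polynomials are proved by evaluation: in characteristic zero, coefficients are
-- determined by the values at the integers greater than 1.

-- `K` is only a Heyting field: equality need not be decidable, and refuting x ≈ 0 does not produce
-- an inverse of x. Distinctness of roots and every cancellation are therefore expressed by explicit
-- inverses (`Unit`), which come from the two apartness hypotheses, on the powers of ζ and on the
-- positive integers. The symmetry of Φₙ comes from ζ^(n-k) being the inverse of ζ^k, which
-- determines the reversed polynomial only up to the factor Φₙ(0); that this factor is 1 is then
-- read off at the point 1. That Φₙ(1) divides m has to hold in ℤ, since in a field it would say
-- almost nothing. This is why the cofactor must be integral, and why the integer inverse of the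
-- constant term is carried along with integrality (`Unital`). Comparing values spares the ring laws
-- for coefficient lists: reordering and regrouping of factors take place in `K`.

-- Filtered and duplicate-free lists

module _ {a} {A : Set a} where

  filter-filter : ∀ {p q r} {P : Pred A p} {Q : Pred A q} {R : Pred A r}
                  (P? : Decidable P) (Q? : Decidable Q) (R? : Decidable R) →
                  (∀ {x} → R x → P x × Q x) → (∀ {x} → P x → Q x → R x) →
                  ∀ xs → filter P? (filter Q? xs) ≡ filter R? xs
  filter-filter P? Q? R? to from []       = ≡.refl
  filter-filter P? Q? R? to from (x ∷ xs) with Q? x
  ... | no ¬q = ≡.trans (filter-filter P? Q? R? to from xs) (≡.sym (Listₚ.filter-reject R? (¬q ∘ proj₂ ∘ to)))
  ... | yes q with P? x
  ...   | no ¬p = ≡.trans (filter-filter P? Q? R? to from xs) (≡.sym (Listₚ.filter-reject R? (¬p ∘ proj₁ ∘ to)))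
  ...   | yes p = ≡.trans (≡.cong (x ∷_) (filter-filter P? Q? R? to from xs))
                          (≡.sym (Listₚ.filter-accept R? (from p q)))

  -- Injectivity is asked only on the members of the list because truncated subtraction from n is
  -- injective only on the numbers up to n.
  unique-map⁺ : ∀ {b} {B : Set b} (f : A → B) {xs} →
                (∀ {x y} → x ∈ xs → y ∈ xs → f x ≡ f y → x ≡ y) →
                Unique xs → Unique (map f xs)
  unique-map⁺ f inj []         = []
  unique-map⁺ f inj (x∉ ∷ xs!) =
    Allₚ.map⁺ (All.tabulate λ y∈ fx≡fy → All.lookup x∉ y∈ (inj (here ≡.refl) (there y∈) fx≡fy))
    ∷ unique-map⁺ f (λ x∈ y∈ → inj (there x∈) (there y∈)) xs!

  unique⇒↭ : {xs ys : List A} → Unique xs → Unique ys →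
             (∀ {x} → x ∈ xs → x ∈ ys) → (∀ {x} → x ∈ ys → x ∈ xs) → xs ↭ ys
  unique⇒↭ xs! ys! to from = ∼bag⇒↭ (unique∧set⇒bag xs! ys! (mk⇔ to from))

-- Totatives and the numbers with a given gcd

range : ℕ → List ℕ
range n = map suc (upTo n)

∈-range⁺ : ∀ {k n} → 1 ≤ k → k ≤ n → k ∈ range n
∈-range⁺ (s≤s _) k≤n = ∈ₚ.∈-map⁺ suc (∈ₚ.∈-upTo⁺ k≤n)

∈-range⁻ : ∀ n {k} → k ∈ range n → 1 ≤ k × k ≤ n
∈-range⁻ n k∈ with ∈ₚ.∈-map⁻ suc k∈
... | _ , i∈ , ≡.refl = s≤s z≤n , ∈ₚ.∈-upTo⁻ i∈

range-unique : ∀ n → Unique (range n)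
range-unique n = Uniqueₚ.map⁺ ℕₚ.suc-injective (Uniqueₚ.upTo⁺ n)

coprime? : ∀ n → Decidable (λ k → gcd k n ≡ 1)
coprime? n k = gcd k n ℕₚ.≟ 1

totatives-unique : ∀ n → Unique (totatives n)
totatives-unique n = Uniqueₚ.filter⁺ (coprime? n) (range-unique n)

∈-totatives⁺ : ∀ {k n} → 1 ≤ k → k ≤ n → gcd k n ≡ 1 → k ∈ totatives n
∈-totatives⁺ {n = n} 1≤k k≤n = ∈ₚ.∈-filter⁺ (coprime? n) (∈-range⁺ 1≤k k≤n)

∈-totatives⁻ : ∀ n {k} → k ∈ totatives n → (1 ≤ k × k ≤ n) × gcd k n ≡ 1
∈-totatives⁻ n k∈ with ∈ₚ.∈-filter⁻ (coprime? n) k∈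
... | k∈range , cop = ∈-range⁻ n k∈range , cop

-- The reflection is its own inverse and gcd(n - k, n) = gcd(k, n). As n ≥ 2 excludes k = n, the
-- value n - k stays positive; for n = 1 the only totative would go to 0. On roots of unity this
-- exchanges ζ^k with its inverse.
totatives-reflect : ∀ {n} → 2 ≤ n → map (n ℕ.∸_) (totatives n) ↭ totatives n
totatives-reflect {n} 2≤n = unique⇒↭
  (unique-map⁺ (n ℕ.∸_) (λ x∈ y∈ → ℕₚ.∸-cancelˡ-≡ (≤n x∈) (≤n y∈)) (totatives-unique n))
  (totatives-unique n) to from
  where
  ≤n : ∀ {k} → k ∈ totatives n → k ≤ n
  ≤n = proj₂ ∘ proj₁ ∘ ∈-totatives⁻ n
  <n : ∀ {k} → k ∈ totatives n → k < n
  <n k∈ = ℕₚ.≤∧≢⇒< (≤n k∈) λ { ≡.refl → ℕₚ.<⇒≢ 2≤n (≡.trans (≡.sym (proj₂ (∈-totatives⁻ n k∈)))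
    (Div.∣-antisym (GCD.gcd[m,n]∣m n n) (GCD.gcd-greatest Div.∣-refl Div.∣-refl))) }
  reflected : ∀ {k} → k ∈ totatives n → n ℕ.∸ k ∈ totatives n
  reflected {k} k∈ = ∈-totatives⁺ (ℕₚ.m<n⇒0<n∸m (<n k∈)) (ℕₚ.m∸n≤m n k)
    (coprime⇒gcd≡1 {n ℕ.∸ k} {n} λ (d∣n∸k , d∣n) → gcd≡1⇒coprime {k} {n} (proj₂ (∈-totatives⁻ n k∈))
      (Div.∣m+n∣m⇒∣n {m = n ℕ.∸ k} {n = k} (≡.subst (_ ∣_) (≡.sym (ℕₚ.m∸n+n≡m (≤n k∈))) d∣n) d∣n∸k , d∣n))
  to : ∀ {k} → k ∈ map (n ℕ.∸_) (totatives n) → k ∈ totatives n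
  to k∈ with ∈ₚ.∈-map⁻ (n ℕ.∸_) k∈
  ... | _ , j∈ , ≡.refl = reflected j∈
  from : ∀ {k} → k ∈ totatives n → k ∈ map (n ℕ.∸_) (totatives n)
  from k∈ = ≡.subst (_∈ map (n ℕ.∸_) (totatives n)) (ℕₚ.m∸[m∸n]≡n (≤n k∈)) (∈ₚ.∈-map⁺ (n ℕ.∸_) (reflected k∈))

module _ (g n : ℕ) .{{_ : NonZero g}} where

  private
    map*-unique : ∀ {xs} → Unique xs → Unique (map (g ℕ.*_) xs)
    map*-unique = Uniqueₚ.map⁺ (ℕₚ.*-cancelˡ-≡ _ _ g)

    g*-range : ∀ {k} → 1 ≤ k → k ≤ n → g ℕ.* k ∈ range (g ℕ.* n)
    g*-range 1≤k k≤n = ∈-range⁺ (ℕₚ.*-mono-≤ (ℕ.>-nonZero⁻¹ g) 1≤k) (ℕₚ.*-monoʳ-≤ g k≤n)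

    multiple : ∀ {k} → k ∈ range (g ℕ.* n) → g ∣ k → ∃[ j ] k ≡ g ℕ.* j × 1 ≤ j × j ≤ n
    multiple k∈ (divides j ≡.refl) with ∈-range⁻ (g ℕ.* n) k∈
    ... | 1≤k , k≤gn rewrite ℕₚ.*-comm j g =
      j , ≡.refl , ℕₚ.n≢0⇒n>0 (λ { ≡.refl → ℕₚ.<⇒≢ 1≤k (≡.sym (ℕₚ.*-zeroʳ g)) }) , ℕₚ.*-cancelˡ-≤ g k≤gn

  filter-multiples : filter (g ∣?_) (range (g ℕ.* n)) ↭ map (g ℕ.*_) (range n)
  filter-multiples = unique⇒↭ (Uniqueₚ.filter⁺ (g ∣?_) (range-unique (g ℕ.* n))) (map*-unique (range-unique n)) to from
    where
    to : ∀ {k} → k ∈ filter (g ∣?_) (range (g ℕ.* n)) → k ∈ map (g ℕ.*_) (range n)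
    to k∈ with ∈ₚ.∈-filter⁻ (g ∣?_) k∈
    ... | k∈range , g∣k with multiple k∈range g∣k
    ... | j , ≡.refl , 1≤j , j≤n = ∈ₚ.∈-map⁺ (g ℕ.*_) (∈-range⁺ 1≤j j≤n)
    from : ∀ {k} → k ∈ map (g ℕ.*_) (range n) → k ∈ filter (g ∣?_) (range (g ℕ.* n))
    from k∈ with ∈ₚ.∈-map⁻ (g ℕ.*_) k∈
    ... | j , j∈ , ≡.refl with ∈-range⁻ n j∈
    ... | 1≤j , j≤n = ∈ₚ.∈-filter⁺ (g ∣?_) (g*-range 1≤j j≤n) (Div.m∣m*n j)

  -- This rests on gcd(g j, g n) = g gcd(j, n). For these exponents ζ^k = (ζ^g)^j with j prime to n,
  -- so together they contribute the cyclotomic polynomial of order n.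
  filter-gcd : filter (λ k → gcd k (g ℕ.* n) ℕₚ.≟ g) (range (g ℕ.* n)) ↭ map (g ℕ.*_) (totatives n)
  filter-gcd = unique⇒↭ (Uniqueₚ.filter⁺ gcd≟ (range-unique (g ℕ.* n))) (map*-unique (totatives-unique n)) to from
    where
    gcd≟ = λ k → gcd k (g ℕ.* n) ℕₚ.≟ g
    to : ∀ {k} → k ∈ filter gcd≟ (range (g ℕ.* n)) → k ∈ map (g ℕ.*_) (totatives n)
    to {k} k∈ with ∈ₚ.∈-filter⁻ gcd≟ k∈
    ... | k∈range , gcd≡g with multiple k∈range (≡.subst (_∣ k) gcd≡g (GCD.gcd[m,n]∣m k (g ℕ.* n)))
    ... | j , ≡.refl , 1≤j , j≤n = ∈ₚ.∈-map⁺ (g ℕ.*_) (∈-totatives⁺ 1≤j j≤n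
      (ℕₚ.*-cancelˡ-≡ _ 1 g (≡.trans (GCD.c*gcd[m,n]≡gcd[cm,cn] g j n) (≡.trans gcd≡g (≡.sym (ℕₚ.*-identityʳ g))))))
    from : ∀ {k} → k ∈ map (g ℕ.*_) (totatives n) → k ∈ filter gcd≟ (range (g ℕ.* n))
    from k∈ with ∈ₚ.∈-map⁻ (g ℕ.*_) k∈
    ... | j , j∈ , ≡.refl with ∈-totatives⁻ n j∈
    ... | (1≤j , j≤n) , cop = ∈ₚ.∈-filter⁺ gcd≟ (g*-range 1≤j j≤n)
      (≡.trans (≡.sym (GCD.c*gcd[m,n]≡gcd[cm,cn] g j n)) (≡.trans (≡.cong (g ℕ.*_) cop) (ℕₚ.*-identityʳ g)))

-- Odd numbers and powers of two

-- An odd m is coprime to 2, so the factors 2 can be cancelled from the divisibility one at a time.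
odd∣2^⇒≡1 : ∀ {m} → 2 ∤ m → ∀ k → m ∣ 2 ℕ.^ k → m ≡ 1
odd∣2^⇒≡1 2∤m zero    m∣ = Div.∣1⇒≡1 m∣
odd∣2^⇒≡1 {m} 2∤m (suc k) m∣ = odd∣2^⇒≡1 2∤m k (coprime-divisor {n = 2} coprime m∣)
  where
  coprime : Coprime m 2
  coprime (i∣m , i∣2) with irreducible[2] i∣2
  ... | inj₁ i≡1    = i≡1
  ... | inj₂ ≡.refl = contradiction i∣m 2∤m

-- The only prime of the modulus is 2. The exponent has the form `suc h` because even k are coprime
-- to 2^0 = 1.
odd⇔coprime-2^ : ∀ k h → (2 ∤ k → gcd k (2 ℕ.^ suc h) ≡ 1) × (gcd k (2 ℕ.^ suc h) ≡ 1 → 2 ∤ k)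
odd⇔coprime-2^ k h =
    (λ 2∤k → odd∣2^⇒≡1 (λ 2∣g → 2∤k (Div.∣-trans 2∣g (GCD.gcd[m,n]∣m k _))) (suc h) (GCD.gcd[m,n]∣n k _))
  , (λ cop 2∣k → contradiction (gcd≡1⇒coprime cop (2∣k , Div.m∣m*n (2 ℕ.^ h))) λ ())

odd-part : ∀ n → .{{NonZero n}} → ∃[ a ] ∃[ m ] n ≡ m ℕ.* 2 ℕ.^ a × 2 ∤ m
odd-part = <-rec _ step
  where
  step : ∀ n → (∀ {k} → k < n → .{{NonZero k}} → ∃[ a ] ∃[ m ] k ≡ m ℕ.* 2 ℕ.^ a × 2 ∤ m) →
         .{{NonZero n}} → ∃[ a ] ∃[ m ] n ≡ m ℕ.* 2 ℕ.^ a × 2 ∤ m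
  step n rec with 2 ∣? n
  ... | no 2∤n = 0 , n , ≡.sym (ℕₚ.*-identityʳ n) , 2∤n
  ... | yes (divides k@(suc k-1) ≡.refl) with rec (ℕₚ.m<m*n k 2 (s≤s (s≤s z≤n)))
  ...   | a , m , eq , 2∤m = suc a , m , (begin
    k ℕ.* 2              ≡⟨ ≡.cong (ℕ._* 2) eq ⟩
    m ℕ.* 2 ℕ.^ a ℕ.* 2  ≡⟨ ℕₚ.*-assoc m (2 ℕ.^ a) 2 ⟩
    m ℕ.* (2 ℕ.^ a ℕ.* 2) ≡⟨ ≡.cong (m ℕ.*_) (ℕₚ.*-comm (2 ℕ.^ a) 2) ⟩
    m ℕ.* 2 ℕ.^ suc a    ∎) , 2∤m
    where open ≡.≡-Reasoning

-- Parity of integers and palindromic lists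

infix 4 _∤ℤ_

_∤ℤ_ : ℤ → ℤ → Set
i ∤ℤ j = ¬ (i ∣ℤ j)

odd⁺ : ∀ {i} → + 2 ∤ℤ i → OddInteger i
odd⁺ {i} 2∤i with i ℤDivMod.%ℕ 2 | ℤDivMod.n%ℕd<d i 2 | ℤDivMod.a≡a%ℕn+[a/ℕn]*n i 2
... | 0 | _ | eq = contradiction (Signed.divides (i ℤDivMod./ℕ 2) (≡.trans eq (ℤₚ.+-identityˡ _))) 2∤i
... | 1 | _ | eq = i ℤDivMod./ℕ 2 ,
  ≡.trans eq (≡.trans (ℤₚ.+-comm (+ 1) ((i ℤDivMod./ℕ 2) ℤ.* + 2)) (≡.cong (ℤ._+ + 1) (ℤₚ.*-comm (i ℤDivMod./ℕ 2) (+ 2))))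
... | suc (suc _) | s≤s (s≤s ()) | _

∤-factor : ∀ {i j m} → i ℤ.* j ≡ + m → 2 ∤ m → + 2 ∤ℤ i
∤-factor {i} {j} {m} ij≡m 2∤m 2∣i =
  2∤m (Signed.∣⇒∣ᵤ (≡.subst (+ 2 ∣ℤ_) ij≡m (Signed.∣m⇒∣m*n {+ 2} {i} j 2∣i)))

sumℤ : List ℤ → ℤ
sumℤ = foldr ℤ._+_ (+ 0)

sumℤ-++ : ∀ is js → sumℤ (is ++ js) ≡ sumℤ is ℤ.+ sumℤ js
sumℤ-++ []       js = ≡.sym (ℤₚ.+-identityˡ _)
sumℤ-++ (i ∷ is) js = ≡.trans (≡.cong (ℤ._+_ i) (sumℤ-++ is js)) (≡.sym (ℤₚ.+-assoc i (sumℤ is) (sumℤ js)))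

sumℤ-reverse : ∀ is → sumℤ (reverse is) ≡ sumℤ is
sumℤ-reverse []       = ≡.refl
sumℤ-reverse (i ∷ is) = begin
  sumℤ (reverse (i ∷ is))          ≡⟨ ≡.cong sumℤ (Listₚ.unfold-reverse i is) ⟩
  sumℤ (reverse is ++ [ i ])       ≡⟨ sumℤ-++ (reverse is) [ i ] ⟩
  sumℤ (reverse is) ℤ.+ (i ℤ.+ + 0) ≡⟨ ≡.cong₂ ℤ._+_ (sumℤ-reverse is) (ℤₚ.+-identityʳ i) ⟩
  sumℤ is ℤ.+ i                    ≡⟨ ℤₚ.+-comm (sumℤ is) i ⟩
  i ℤ.+ sumℤ is                    ∎
  where open ≡.≡-Reasoning

2∣i+i : ∀ i → + 2 ∣ℤ i ℤ.+ i
2∣i+i i = Signed.divides i (begin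
  i ℤ.+ i                    ≡⟨ ≡.cong₂ ℤ._+_ (ℤₚ.*-identityʳ i) (ℤₚ.*-identityʳ i) ⟨
  i ℤ.* + 1 ℤ.+ i ℤ.* + 1    ≡⟨ ℤₚ.*-distribˡ-+ i (+ 1) (+ 1) ⟨
  i ℤ.* + 2                  ∎)
  where open ≡.≡-Reasoning

++-injective : ∀ {a} {A : Set a} (ws ys : List A) {xs zs} → length ws ≡ length ys →
               ws ++ xs ≡ ys ++ zs → ws ≡ ys × xs ≡ zs
++-injective []       []       _  eq = ≡.refl , eq
++-injective (w ∷ ws) (y ∷ ys) |≡| eq with Listₚ.∷-injective eq
... | ≡.refl , eq′ with ++-injective ws ys (ℕₚ.suc-injective |≡|) eq′
...   | ≡.refl , xs≡zs = ≡.refl , xs≡zs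

halve : ∀ n → ∃[ h ] (n ≡ h ℕ.+ h ⊎ n ≡ suc (h ℕ.+ h))
halve zero = 0 , inj₁ ≡.refl
halve (suc n) with halve n
... | h , inj₁ eq = h , inj₂ (≡.cong suc eq)
... | h , inj₂ eq = suc h , inj₁ (≡.cong suc (≡.trans eq (≡.sym (ℕₚ.+-suc h h))))

split-at : ∀ {a} {A : Set a} (zs : List A) h {k} → length zs ≡ h ℕ.+ k →
           ∃[ xs ] ∃[ ys ] zs ≡ xs ++ ys × length xs ≡ h × length ys ≡ k
split-at zs h {k} |zs| = take h zs , drop h zs , ≡.sym (Listₚ.take++drop≡id h zs)
  , ≡.trans (Listₚ.length-take h zs) (ℕₚ.m≤n⇒m⊓n≡m (≡.subst (h ≤_) (≡.sym |zs|) (ℕₚ.m≤m+n h k)))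
  , ≡.trans (Listₚ.length-drop h zs) (≡.trans (≡.cong (ℕ._∸ h) |zs|) (ℕₚ.m+n∸m≡n h k))

-- Reversal exchanges the two halves, so they have equal sums. With an even length the total would
-- be even; with an odd length it is c plus twice a half, so c has the parity of the total. The odd
-- length is part of the conclusion because it later shows that φ(n) is even.
palindrome-middle : ∀ zs → reverse zs ≡ zs → + 2 ∤ℤ sumℤ zs →
                    ∃[ xs ] ∃[ c ] ∃[ ys ]
                    zs ≡ xs ++ c ∷ ys × length zs ≡ suc (length xs ℕ.+ length xs) × + 2 ∤ℤ c
palindrome-middle zs rev 2∤sum with halve (length zs)
... | h , inj₁ |zs| with split-at zs h |zs|
...   | xs , ys , ≡.refl , |xs| , |ys|
  with ++-injective (reverse ys) xs (≡.trans (Listₚ.length-reverse ys) (≡.trans |ys| (≡.sym |xs|)))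
         (≡.trans (≡.sym (Listₚ.reverse-++ xs ys)) rev)
...     | ≡.refl , _ = contradiction (≡.subst (+ 2 ∣ℤ_) (begin
  sumℤ ys ℤ.+ sumℤ ys                ≡⟨ ≡.cong (ℤ._+ sumℤ ys) (sumℤ-reverse ys) ⟨
  sumℤ (reverse ys) ℤ.+ sumℤ ys      ≡⟨ sumℤ-++ (reverse ys) ys ⟨
  sumℤ (reverse ys ++ ys)            ∎) (2∣i+i (sumℤ ys))) 2∤sum
  where open ≡.≡-Reasoning
palindrome-middle zs rev 2∤sum | h , inj₂ |zs| with split-at zs h (≡.trans |zs| (≡.sym (ℕₚ.+-suc h h)))
...   | xs , c ∷ ys , ≡.refl , |xs| , |ys|
  with ++-injective (reverse ys) xs (≡.trans (Listₚ.length-reverse ys) (≡.trans (ℕₚ.suc-injective |ys|) (≡.sym |xs|)))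
         (begin
            reverse ys ++ c ∷ reverse xs          ≡⟨ Listₚ.++-assoc (reverse ys) [ c ] (reverse xs) ⟨
            (reverse ys ++ [ c ]) ++ reverse xs   ≡⟨ ≡.cong (_++ reverse xs) (Listₚ.unfold-reverse c ys) ⟨
            reverse (c ∷ ys) ++ reverse xs        ≡⟨ Listₚ.reverse-++ xs (c ∷ ys) ⟨
            reverse (xs ++ c ∷ ys)                ≡⟨ rev ⟩
            xs ++ c ∷ ys                          ∎)
  where open ≡.≡-Reasoning
...     | ≡.refl , _ = reverse ys , c , ys , ≡.refl
  , ≡.trans |zs| (≡.cong (λ k → suc (k ℕ.+ k)) (≡.sym |xs|))
  , λ 2∣c → 2∤sum (≡.subst (+ 2 ∣ℤ_) (begin
      c ℤ.+ (sumℤ ys ℤ.+ sumℤ ys)                 ≡⟨ x∙yz≈y∙xz c (sumℤ ys) (sumℤ ys) ⟩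
      sumℤ ys ℤ.+ (c ℤ.+ sumℤ ys)                 ≡⟨ ≡.cong (ℤ._+ (c ℤ.+ sumℤ ys)) (sumℤ-reverse ys) ⟨
      sumℤ (reverse ys) ℤ.+ sumℤ (c ∷ ys)         ≡⟨ sumℤ-++ (reverse ys) (c ∷ ys) ⟨
      sumℤ (reverse ys ++ c ∷ ys)                 ∎) (Signed.∣m∣n⇒∣m+n 2∣c (2∣i+i (sumℤ ys))))
  where
  open ≡.≡-Reasoning
  open CommutativeSemigroupProperties ℤₚ.+-commutativeSemigroup using (x∙yz≈y∙xz)

module CharacteristicZeroField {a ℓ₁ ℓ₂} (K : HeytingField a ℓ₁ ℓ₂)
  (char0 : OverField.CharacteristicZero K) where

  open OverField K
  open HeytingField K using (_#_; #⇒invertible; #-irrefl)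
  open CommutativeRing commutativeRing
  open GroupProperties +-group using (x∙y⁻¹≈ε⇒x≈y; x≈y⇒x∙y⁻¹≈ε; ε⁻¹≈ε; ⁻¹-involutive)
  open AbelianGroupProperties +-abelianGroup using (⁻¹-∙-comm)
  open CommutativeSemigroupProperties +-commutativeSemigroup using (interchange)
  open RingProperties ring using (-‿distribˡ-*; -‿distribʳ-*)
  open Exp commutativeSemiring using (_^_; ^-congˡ; ^-homo-*; ^-assocʳ)
  open Mult semiring using (×-homo-+; ×1-homo-*) renaming (_×_ to _·_)
  open import Relation.Binary.Reasoning.Setoid setoid

  -- The image of ℤ in the field

  fromℤ-neg : ∀ i → fromℤ (ℤ.- i) ≈ - fromℤ i
  fromℤ-neg (+ zero)  = sym ε⁻¹≈ε
  fromℤ-neg (+ suc m) = refl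
  fromℤ-neg -[1+ m ]  = sym (⁻¹-involutive _)

  fromℤ-⊖ : ∀ m n → fromℤ (m ⊖ n) ≈ m · 1# - n · 1#
  fromℤ-⊖ zero    zero    = sym (-‿inverseʳ 0#)
  fromℤ-⊖ zero    (suc n) = sym (+-identityˡ _)
  fromℤ-⊖ (suc m) zero    = sym (trans (+-congˡ ε⁻¹≈ε) (+-identityʳ _))
  fromℤ-⊖ (suc m) (suc n) = begin
    fromℤ (suc m ⊖ suc n)                  ≡⟨ ≡.cong fromℤ (ℤₚ.[1+m]⊖[1+n]≡m⊖n m n) ⟩
    fromℤ (m ⊖ n)                          ≈⟨ fromℤ-⊖ m n ⟩
    m · 1# - n · 1#                        ≈⟨ +-identityˡ _ ⟨
    0# + (m · 1# - n · 1#)                 ≈⟨ +-congʳ (-‿inverseʳ 1#) ⟨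
    (1# - 1#) + (m · 1# - n · 1#)          ≈⟨ interchange _ _ _ _ ⟩
    (1# + m · 1#) + (- 1# - n · 1#)        ≈⟨ +-congˡ (⁻¹-∙-comm _ _) ⟩
    suc m · 1# - suc n · 1#                ∎

  fromℤ-+ : ∀ i j → fromℤ (i ℤ.+ j) ≈ fromℤ i + fromℤ j
  fromℤ-+ (+ m)    (+ n)    = ×-homo-+ 1# m n
  fromℤ-+ (+ m)    -[1+ n ] = fromℤ-⊖ m (suc n)
  fromℤ-+ -[1+ m ] (+ n)    = trans (fromℤ-⊖ n (suc m)) (+-comm _ _)
  fromℤ-+ -[1+ m ] -[1+ n ] = begin
    - (suc (suc (m ℕ.+ n)) · 1#)     ≡⟨ ≡.cong (λ k → - (suc k · 1#)) (ℕₚ.+-suc m n) ⟨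
    - ((suc m ℕ.+ suc n) · 1#)       ≈⟨ -‿cong (×-homo-+ 1# (suc m) (suc n)) ⟩
    - (suc m · 1# + suc n · 1#)      ≈⟨ ⁻¹-∙-comm _ _ ⟨
    - (suc m · 1#) - suc n · 1#      ∎

  fromℤ-* : ∀ i j → fromℤ (i ℤ.* j) ≈ fromℤ i * fromℤ j
  fromℤ-* (+ m)    (+ n)    = begin
    fromℤ (+ m ℤ.* + n)   ≡⟨ ≡.cong fromℤ (ℤₚ.pos-* m n) ⟨
    (m ℕ.* n) · 1#        ≈⟨ ×1-homo-* m n ⟩
    m · 1# * n · 1#       ∎
  fromℤ-* (+ m)    -[1+ n ] = begin
    fromℤ (+ m ℤ.* -[1+ n ])    ≡⟨ ≡.cong fromℤ (ℤₚ.neg-distribʳ-* (+ m) (+ suc n)) ⟨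
    fromℤ (ℤ.- (+ m ℤ.* + suc n)) ≈⟨ fromℤ-neg (+ m ℤ.* + suc n) ⟩
    - fromℤ (+ m ℤ.* + suc n)     ≈⟨ -‿cong (fromℤ-* (+ m) (+ suc n)) ⟩
    - (m · 1# * suc n · 1#)       ≈⟨ -‿distribʳ-* _ _ ⟩
    m · 1# * - (suc n · 1#)       ∎
  fromℤ-* -[1+ m ] (+ n)    = begin
    fromℤ (-[1+ m ] ℤ.* + n)    ≡⟨ ≡.cong fromℤ (ℤₚ.neg-distribˡ-* (+ suc m) (+ n)) ⟨
    fromℤ (ℤ.- (+ suc m ℤ.* + n)) ≈⟨ fromℤ-neg (+ suc m ℤ.* + n) ⟩
    - fromℤ (+ suc m ℤ.* + n)     ≈⟨ -‿cong (fromℤ-* (+ suc m) (+ n)) ⟩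
    - (suc m · 1# * n · 1#)       ≈⟨ -‿distribˡ-* _ _ ⟩
    - (suc m · 1#) * n · 1#       ∎
  fromℤ-* -[1+ m ] -[1+ n ] = begin
    (suc m ℕ.* suc n) · 1#             ≈⟨ ×1-homo-* (suc m) (suc n) ⟩
    suc m · 1# * suc n · 1#            ≈⟨ ⁻¹-involutive _ ⟨
    - - (suc m · 1# * suc n · 1#)      ≈⟨ -‿cong (-‿distribʳ-* _ _) ⟩
    - (suc m · 1# * - (suc n · 1#))    ≈⟨ -‿distribˡ-* _ _ ⟩
    - (suc m · 1#) * - (suc n · 1#)    ∎

  fromℤ-1 : fromℤ (+ 1) ≈ 1#
  fromℤ-1 = +-identityʳ 1#

  private
    -- The integers as coefficients of the ring solver, with 1 interpreted as 1#
    -- rather than as fromℤ (+ 1) = 1# + 0#.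
    ⟦_⟧ : ℤ → Carrier
    ⟦ + 1 ⟧ = 1#
    ⟦ i ⟧   = fromℤ i

    ⟦⟧≈fromℤ : ∀ i → ⟦ i ⟧ ≈ fromℤ i
    ⟦⟧≈fromℤ (+ 0)           = refl
    ⟦⟧≈fromℤ (+ 1)           = sym fromℤ-1
    ⟦⟧≈fromℤ (+ suc (suc m)) = refl
    ⟦⟧≈fromℤ -[1+ m ]        = refl

    ⟦⟧-morphism : ℤ.+-*-rawRing -Raw-AlmostCommutative⟶ fromCommutativeRing commutativeRing
    ⟦⟧-morphism = record
      { ⟦_⟧    = ⟦_⟧
      ; +-homo = λ i j → trans (⟦⟧≈fromℤ (i ℤ.+ j)) (trans (fromℤ-+ i j)
                   (sym (+-cong (⟦⟧≈fromℤ i) (⟦⟧≈fromℤ j))))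
      ; *-homo = λ i j → trans (⟦⟧≈fromℤ (i ℤ.* j)) (trans (fromℤ-* i j)
                   (sym (*-cong (⟦⟧≈fromℤ i) (⟦⟧≈fromℤ j))))
      ; -‿homo = λ i → trans (⟦⟧≈fromℤ (ℤ.- i)) (trans (fromℤ-neg i)
                   (sym (-‿cong (⟦⟧≈fromℤ i))))
      ; 0-homo = refl
      ; 1-homo = refl
      }

  open RingSolver ℤ.+-*-rawRing (fromCommutativeRing commutativeRing) ⟦⟧-morphism
    (λ i j → Maybe.map (λ i≡j → reflexive (≡.cong ⟦_⟧ i≡j)) (dec⇒maybe (i ℤₚ.≟ j)))
    using (solve; _:=_; _:+_; _:*_; _:-_; :-_; con)

  -- Units and cancellation

  Unit : Carrier → Set (a ⊔ ℓ₁)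
  Unit x = ∃[ y ] x * y ≈ 1#

  unit-resp-≈ : ∀ {x y} → x ≈ y → Unit x → Unit y
  unit-resp-≈ x≈y (z , xz≈1) = z , trans (*-congʳ (sym x≈y)) xz≈1

  unit-* : ∀ {x y} → Unit x → Unit y → Unit (x * y)
  unit-* {x} {y} (u , xu≈1) (v , yv≈1) = u * v , (begin
    (x * y) * (u * v)  ≈⟨ solve 4 (λ x y u v → (x :* y) :* (u :* v) := (x :* u) :* (y :* v)) refl x y u v ⟩
    (x * u) * (y * v)  ≈⟨ *-cong xu≈1 yv≈1 ⟩
    1# * 1#            ≈⟨ *-identityˡ 1# ⟩
    1#                 ∎)

  unit-^ : ∀ {x} → Unit x → ∀ n → Unit (x ^ n)
  unit-^ ux zero    = 1# , *-identityˡ 1#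
  unit-^ ux (suc n) = unit-* ux (unit-^ ux n)

  unit-cancel : ∀ {x z} → Unit x → x * z ≈ 0# → z ≈ 0#
  unit-cancel {x} {z} (y , xy≈1) xz≈0 = begin
    z            ≈⟨ *-identityˡ z ⟨
    1# * z       ≈⟨ *-congʳ xy≈1 ⟨
    (x * y) * z  ≈⟨ solve 3 (λ x y z → (x :* y) :* z := y :* (x :* z)) refl x y z ⟩
    y * (x * z)  ≈⟨ *-congˡ xz≈0 ⟩
    y * 0#       ≈⟨ zeroʳ y ⟩
    0#           ∎

  unit-cancelˡ : ∀ {x y z} → Unit x → x * y ≈ x * z → y ≈ z
  unit-cancelˡ {x} {y} {z} ux xy≈xz = x∙y⁻¹≈ε⇒x≈y y z (unit-cancel ux (begin
    x * (y - z)    ≈⟨ solve 3 (λ x y z → x :* (y :- z) := x :* y :- x :* z) refl x y z ⟩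
    x * y - x * z  ≈⟨ x≈y⇒x∙y⁻¹≈ε xy≈xz ⟩
    0#             ∎))

  -- Values and coefficients of polynomials

  eval : Poly → Carrier → Carrier
  eval []      x = 0#
  eval (c ∷ p) x = c + x * eval p x

  eval-cong : ∀ p {x y} → x ≈ y → eval p x ≈ eval p y
  eval-cong []      x≈y = refl
  eval-cong (c ∷ p) x≈y = +-congˡ (*-cong x≈y (eval-cong p x≈y))

  eval-+ᵖ : ∀ p q x → eval (p +ᵖ q) x ≈ eval p x + eval q x
  eval-+ᵖ []      q       x = sym (+-identityˡ _)
  eval-+ᵖ (c ∷ p) []      x = sym (+-identityʳ _)
  eval-+ᵖ (c ∷ p) (d ∷ q) x = begin
    (c + d) + x * eval (p +ᵖ q) x              ≈⟨ +-congˡ (*-congˡ (eval-+ᵖ p q x)) ⟩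
    (c + d) + x * (eval p x + eval q x)
      ≈⟨ solve 5 (λ c d x p q → (c :+ d) :+ x :* (p :+ q) := (c :+ x :* p) :+ (d :+ x :* q)) refl
           c d x (eval p x) (eval q x) ⟩
    (c + x * eval p x) + (d + x * eval q x)    ∎

  eval-map* : ∀ c p x → eval (map (c *_) p) x ≈ c * eval p x
  eval-map* c []      x = sym (zeroʳ c)
  eval-map* c (d ∷ p) x = begin
    c * d + x * eval (map (c *_) p) x  ≈⟨ +-congˡ (*-congˡ (eval-map* c p x)) ⟩
    c * d + x * (c * eval p x)
      ≈⟨ solve 4 (λ c d x p → c :* d :+ x :* (c :* p) := c :* (d :+ x :* p)) refl c d x (eval p x) ⟩
    c * (d + x * eval p x)             ∎

  eval-*ᵖ : ∀ p q x → eval (p *ᵖ q) x ≈ eval p x * eval q x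
  eval-*ᵖ []      q x = sym (zeroˡ _)
  eval-*ᵖ (c ∷ p) q x = begin
    eval (map (c *_) q +ᵖ (0# ∷ p *ᵖ q)) x                ≈⟨ eval-+ᵖ (map (c *_) q) _ x ⟩
    eval (map (c *_) q) x + (0# + x * eval (p *ᵖ q) x)
      ≈⟨ +-cong (eval-map* c q x) (+-congˡ (*-congˡ (eval-*ᵖ p q x))) ⟩
    c * eval q x + (0# + x * (eval p x * eval q x))
      ≈⟨ solve 4 (λ c x p q → c :* q :+ (con (+ 0) :+ x :* (p :* q)) := (c :+ x :* p) :* q) refl
           c x (eval p x) (eval q x) ⟩
    (c + x * eval p x) * eval q x                         ∎

  eval-++ : ∀ p q x → eval (p ++ q) x ≈ eval p x + x ^ length p * eval q x
  eval-++ []      q x = solve 1 (λ q → q := con (+ 0) :+ con (+ 1) :* q) refl (eval q x)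
  eval-++ (c ∷ p) q x = begin
    c + x * eval (p ++ q) x                            ≈⟨ +-congˡ (*-congˡ (eval-++ p q x)) ⟩
    c + x * (eval p x + x ^ length p * eval q x)
      ≈⟨ solve 5 (λ c x p y q → c :+ x :* (p :+ y :* q) := (c :+ x :* p) :+ (x :* y) :* q) refl
           c x (eval p x) (x ^ length p) (eval q x) ⟩
    (c + x * eval p x) + (x * x ^ length p) * eval q x ∎

  eval-X- : ∀ r x → eval (X- r) x ≈ x - r
  eval-X- r x = solve 2 (λ r x → :- r :+ x :* (con (+ 1) :+ x :* con (+ 0)) := x :- r) refl r x

  monomial : ℕ → Poly
  monomial n = replicate n 0# ++ [ 1# ]

  eval-monomial : ∀ n x → eval (monomial n) x ≈ x ^ n
  eval-monomial zero    x = trans (+-congˡ (zeroʳ x)) (+-identityʳ 1#)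
  eval-monomial (suc n) x = trans (+-identityˡ _) (*-congˡ (eval-monomial n x))

  coeff-monomial-≡ : ∀ n → coeff (monomial n) n ≈ 1#
  coeff-monomial-≡ zero    = refl
  coeff-monomial-≡ (suc n) = coeff-monomial-≡ n

  coeff-monomial-≢ : ∀ n i → i ≢ n → coeff (monomial n) i ≈ 0#
  coeff-monomial-≢ zero    zero    i≢n = contradiction ≡.refl i≢n
  coeff-monomial-≢ zero    (suc i) i≢n = refl
  coeff-monomial-≢ (suc n) zero    i≢n = refl
  coeff-monomial-≢ (suc n) (suc i) i≢n = coeff-monomial-≢ n i (i≢n ∘ ≡.cong suc)

  coeff-+ᵖ : ∀ p q i → coeff (p +ᵖ q) i ≈ coeff p i + coeff q i
  coeff-+ᵖ []      q       i       = sym (+-identityˡ _)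
  coeff-+ᵖ (c ∷ p) []      i       = sym (+-identityʳ _)
  coeff-+ᵖ (c ∷ p) (d ∷ q) zero    = refl
  coeff-+ᵖ (c ∷ p) (d ∷ q) (suc i) = coeff-+ᵖ p q i

  coeff-map* : ∀ c p i → coeff (map (c *_) p) i ≈ c * coeff p i
  coeff-map* c []      i       = sym (zeroʳ c)
  coeff-map* c (d ∷ p) zero    = refl
  coeff-map* c (d ∷ p) (suc i) = coeff-map* c p i

  coeff-≥length : ∀ p {i} → length p ≤ i → coeff p i ≈ 0#
  coeff-≥length []      _         = refl
  coeff-≥length (c ∷ p) (s≤s p≤i) = coeff-≥length p p≤i

  length-+ᵖ : ∀ p q → length (p +ᵖ q) ≡ length p ℕ.⊔ length q
  length-+ᵖ []      q       = ≡.refl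
  length-+ᵖ (c ∷ p) []      = ≡.refl
  length-+ᵖ (c ∷ p) (d ∷ q) = ≡.cong suc (length-+ᵖ p q)

  -- Division by linear factors and counting of roots

  -- The quotient of c ∷ p by X - r: the remainder is eval (c ∷ p) r, whence c is irrelevant.
  quotient : Carrier → Poly → Poly
  quotient r []      = []
  quotient r (c ∷ p) = eval (c ∷ p) r ∷ quotient r p

  length-quotient : ∀ r p → length (quotient r p) ≡ length p
  length-quotient r []      = ≡.refl
  length-quotient r (c ∷ p) = ≡.cong suc (length-quotient r p)

  -- Horner's scheme reduces this to x u - r v = (x - r) v + x (u - v), where u - v is the same
  -- difference for the tail.
  eval-quotient : ∀ r c p x → eval (c ∷ p) x - eval (c ∷ p) r ≈ (x - r) * eval (quotient r p) x
  eval-quotient r c []      x =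
    solve 3 (λ r c x → (c :+ x :* con (+ 0)) :- (c :+ r :* con (+ 0)) := (x :- r) :* con (+ 0)) refl r c x
  eval-quotient r c (d ∷ p) x = begin
    (c + x * eval (d ∷ p) x) - (c + r * eval (d ∷ p) r)
      ≈⟨ solve 5 (λ c x r u v → (c :+ x :* u) :- (c :+ r :* v) := (x :- r) :* v :+ x :* (u :- v)) refl
           c x r (eval (d ∷ p) x) (eval (d ∷ p) r) ⟩
    (x - r) * eval (d ∷ p) r + x * (eval (d ∷ p) x - eval (d ∷ p) r)
      ≈⟨ +-congˡ (*-congˡ (eval-quotient r d p x)) ⟩
    (x - r) * eval (d ∷ p) r + x * ((x - r) * eval (quotient r p) x)
      ≈⟨ solve 4 (λ x r v w → (x :- r) :* v :+ x :* ((x :- r) :* w) := (x :- r) :* (v :+ x :* w)) refl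
           x r (eval (d ∷ p) r) (eval (quotient r p) x) ⟩
    (x - r) * (eval (d ∷ p) r + x * eval (quotient r p) x) ∎

  leading-quotient : ∀ r p i → length p ≡ suc i → coeff (quotient r p) i ≈ coeff p i
  leading-quotient r (c ∷ [])    zero    eq = trans (+-congˡ (zeroʳ r)) (+-identityʳ c)
  leading-quotient r (c ∷ d ∷ p) (suc i) eq = leading-quotient r (d ∷ p) i (ℕₚ.suc-injective eq)

  Separated : List Carrier → Set (a ⊔ ℓ₁)
  Separated = AllPairs (λ r s → Unit (s - r))

  Vanishing : Poly → List Carrier → Set (a ⊔ ℓ₁)
  Vanishing p = All (λ r → eval p r ≈ 0#)

  -- At two roots r and s of the polynomial, p(s) - p(r) = (s - r) q(s) leaves (s - r) q(s) = 0, and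
  -- s - r has to be cancelled. This is why `Separated` asks for invertible differences.
  quotient-vanishing : ∀ {r} c p → eval (c ∷ p) r ≈ 0# →
                       ∀ {rs} → All (λ s → Unit (s - r)) rs → Vanishing (c ∷ p) rs →
                       Vanishing (quotient r p) rs
  quotient-vanishing c p pr≈0 [] [] = []
  quotient-vanishing {r} c p pr≈0 {s ∷ _} (u ∷ us) (ps≈0 ∷ eqs) =
    unit-cancel u (begin
      (s - r) * eval (quotient r p) s      ≈⟨ eval-quotient r c p s ⟨
      eval (c ∷ p) s - eval (c ∷ p) r      ≈⟨ +-cong ps≈0 (-‿cong pr≈0) ⟩
      0# - 0#                              ≈⟨ -‿inverseʳ 0# ⟩
      0#                                   ∎)
    ∷ quotient-vanishing c p pr≈0 us eqs

  ∏[x-_] : List Carrier → Carrier → Carrier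
  ∏[x- rs ] x = foldr (λ r y → (x - r) * y) 1# rs

  -- Each root takes one factor X - r off p and leaves the top entry unchanged. As p has just one
  -- entry more than there are roots, that entry is the constant that remains at the end.
  factorisation : ∀ p rs → length p ≡ suc (length rs) → Separated rs → Vanishing p rs →
                  ∀ x → eval p x ≈ coeff p (length rs) * ∏[x- rs ] x
  factorisation (c ∷ []) [] eq [] [] x =
    solve 2 (λ c x → c :+ x :* con (+ 0) := c :* con (+ 1)) refl c x
  factorisation (c ∷ p) (r ∷ rs) eq (u ∷ sep) (pr≈0 ∷ van) x = begin
    eval (c ∷ p) x                             ≈⟨ +-identityʳ _ ⟨
    eval (c ∷ p) x + 0#                        ≈⟨ +-congˡ (trans (-‿cong pr≈0) ε⁻¹≈ε) ⟨
    eval (c ∷ p) x - eval (c ∷ p) r            ≈⟨ eval-quotient r c p x ⟩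
    (x - r) * eval q x                         ≈⟨ *-congˡ (factorisation q rs |q| sep (quotient-vanishing c p pr≈0 u van) x) ⟩
    (x - r) * (coeff q (length rs) * ∏[x- rs ] x)
      ≈⟨ *-congˡ (*-congʳ (leading-quotient r p (length rs) |p|)) ⟩
    (x - r) * (coeff p (length rs) * ∏[x- rs ] x)
      ≈⟨ solve 3 (λ a b c → a :* (b :* c) := b :* (a :* c)) refl (x - r) (coeff p (length rs)) (∏[x- rs ] x) ⟩
    coeff p (length rs) * ((x - r) * ∏[x- rs ] x) ∎
    where
    q = quotient r p
    |p| = ℕₚ.suc-injective eq
    |q| = ≡.trans (length-quotient r p) |p|

  -- The entries of the list are the successive Horner values at r. Each is a coefficient plus r
  -- times the next value, so when all values vanish the coefficients do too.
  quotient≈0 : ∀ r p → All (_≈ 0#) (quotient r p) → All (_≈ 0#) p × eval p r ≈ 0#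
  quotient≈0 r []      []         = [] , refl
  quotient≈0 r (c ∷ p) (e ∷ es) with quotient≈0 r p es
  ... | p≈0 , pr≈0 = (begin
    c                  ≈⟨ +-identityʳ c ⟨
    c + 0#             ≈⟨ +-congˡ (trans (*-congˡ pr≈0) (zeroʳ r)) ⟨
    c + r * eval p r   ≈⟨ e ⟩
    0#                 ∎) ∷ p≈0 , e

  too-many-roots : ∀ p rs → length rs ≡ length p → Separated rs → Vanishing p rs → All (_≈ 0#) p
  too-many-roots []      _        _  _         _            = []
  too-many-roots (c ∷ p) (r ∷ rs) eq (u ∷ sep) (pr≈0 ∷ van) =
    -- For `c ∷ p` the list consists of the remainder, zero because r is a root, followed by the
    -- true quotient, zero by induction on the number of roots.
    proj₁ (quotient≈0 r (c ∷ p)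
      (pr≈0 ∷ too-many-roots (quotient r p) rs
                (≡.trans (ℕₚ.suc-injective eq) (≡.sym (length-quotient r p)))
                sep (quotient-vanishing c p pr≈0 u van)))

  All⇒coeff≈0 : ∀ {p} → All (_≈ 0#) p → ∀ i → coeff p i ≈ 0#
  All⇒coeff≈0 []       i       = refl
  All⇒coeff≈0 (e ∷ es) zero    = e
  All⇒coeff≈0 (e ∷ es) (suc i) = All⇒coeff≈0 es i

  -- Polynomials determined by their values at integers

  infix 4 _≋_

  _≋_ : Poly → Poly → Set ℓ₁
  p ≋ q = ∀ i → coeff p i ≈ coeff q i

  eval-resp-≋ : ∀ {p q} → p ≋ q → ∀ x → eval p x ≈ eval q x
  eval-resp-≋ {[]}    {[]}    eq x = refl
  eval-resp-≋ {[]}    {d ∷ q} eq x = begin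
    0#                   ≈⟨ solve 1 (λ x → con (+ 0) := con (+ 0) :+ x :* con (+ 0)) refl x ⟩
    0# + x * 0#          ≈⟨ +-cong (eq 0) (*-congˡ (eval-resp-≋ {[]} {q} (eq ∘ suc) x)) ⟩
    d + x * eval q x     ∎
  eval-resp-≋ {c ∷ p} {[]}    eq x = begin
    c + x * eval p x     ≈⟨ +-cong (eq 0) (*-congˡ (eval-resp-≋ {p} {[]} (eq ∘ suc) x)) ⟩
    0# + x * 0#          ≈⟨ solve 1 (λ x → con (+ 0) :+ x :* con (+ 0) := con (+ 0)) refl x ⟩
    0#                   ∎
  eval-resp-≋ {c ∷ p} {d ∷ q} eq x = +-cong (eq 0) (*-congˡ (eval-resp-≋ {p} {q} (eq ∘ suc) x))

  #⇒unit : ∀ {x y} → x # y → Unit (x - y)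
  #⇒unit x#y with #⇒invertible x#y
  ... | z , _ , eq = z , eq

  1≉0 : ¬ (1# ≈ 0#)
  1≉0 1≈0 = #-irrefl (trans (+-identityʳ 1#) 1≈0) (char0 0)

  unit-suc : ∀ m → Unit (suc m · 1#)
  unit-suc m = unit-resp-≈ (trans (+-congˡ ε⁻¹≈ε) (+-identityʳ _)) (#⇒unit (char0 m))

  unit-difference : ∀ {m n} → m < n → Unit (n · 1# - m · 1#)
  unit-difference {m} {n} m<n with ℕₚ.m≤n⇒∃[o]m+o≡n m<n
  ... | k , ≡.refl = unit-resp-≈ (begin
    suc k · 1#                           ≈⟨ solve 2 (λ x y → y := (x :+ y) :- x) refl (m · 1#) (suc k · 1#) ⟩
    (m · 1# + suc k · 1#) - m · 1#       ≈⟨ +-congʳ (×-homo-+ 1# m (suc k)) ⟨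
    (m ℕ.+ suc k) · 1# - m · 1#          ≡⟨ ≡.cong (λ i → i · 1# - m · 1#) (ℕₚ.+-suc m k) ⟩
    suc (m ℕ.+ k) · 1# - m · 1#          ∎) (unit-suc k)

  -- Agreement at the integers m ≥ 2, where moreover x and x ^ n - 1 (for n ≥ 1) are units.
  infix 4 _≗₂_

  _≗₂_ : Poly → Poly → Set ℓ₁
  p ≗₂ q = ∀ m → eval p (suc (suc m) · 1#) ≈ eval q (suc (suc m) · 1#)

  -- If p - q has l entries, it vanishes at the l integers 2, ..., l + 1. Their differences are
  -- images of nonzero integers, hence units in characteristic zero, so there are more separated
  -- roots than the degree allows.
  ≗₂⇒≋ : ∀ p q → p ≗₂ q → p ≋ q
  ≗₂⇒≋ p q eq i = x∙y⁻¹≈ε⇒x≈y _ _ (begin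
    coeff p i - coeff q i                  ≈⟨ solve 2 (λ x y → x :- y := x :+ :- con (+ 1) :* y) refl _ _ ⟩
    coeff p i + - 1# * coeff q i           ≈⟨ +-congˡ (coeff-map* (- 1#) q i) ⟨
    coeff p i + coeff (map (- 1# *_) q) i  ≈⟨ coeff-+ᵖ p _ i ⟨
    coeff p-q i                            ≈⟨ All⇒coeff≈0 (too-many-roots p-q points |points| separated vanishing) i ⟩
    0#                                     ∎)
    where
    p-q = p +ᵖ map (- 1# *_) q
    point : ℕ → Carrier
    point m = suc (suc m) · 1#
    points = applyUpTo point (length p-q)
    |points| = Listₚ.length-applyUpTo point (length p-q)
    separated : Separated points
    separated = AllPairsₚ.applyUpTo⁺₁ point (length p-q) (λ i<j _ → unit-difference (s≤s (s≤s i<j)))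
    vanishing : Vanishing p-q points
    vanishing = Allₚ.applyUpTo⁺₂ point (length p-q) (λ m → begin
      eval p-q (point m)                                       ≈⟨ eval-+ᵖ p _ (point m) ⟩
      eval p (point m) + eval (map (- 1# *_) q) (point m)      ≈⟨ +-cong (eq m) (eval-map* (- 1#) q (point m)) ⟩
      eval q (point m) + - 1# * eval q (point m)
        ≈⟨ solve 1 (λ x → x :+ :- con (+ 1) :* x := con (+ 0)) refl _ ⟩
      0#                                                       ∎)

  ^-homo-nat : ∀ m n → (m ℕ.^ n) · 1# ≈ (m · 1#) ^ n
  ^-homo-nat m zero    = +-identityʳ 1#
  ^-homo-nat m (suc n) = trans (×1-homo-* m (m ℕ.^ n)) (*-congˡ (^-homo-nat m n))

  -- The element is the image of a difference of natural numbers, 1 < (m + 2)^n for n ≥ 1.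
  unit-^-1 : ∀ m n → .{{NonZero n}} → Unit ((suc (suc m) · 1#) ^ n - 1#)
  unit-^-1 m n = unit-resp-≈ (+-cong (^-homo-nat (suc (suc m)) n) (-‿cong (+-identityʳ 1#)))
    (unit-difference {1} {suc (suc m) ℕ.^ n} (ℕₚ.^-monoʳ-< (suc (suc m)) (s≤s (s≤s z≤n)) {0} {n} (ℕ.>-nonZero⁻¹ n)))

  fromℤ-injective : ∀ i j → fromℤ i ≈ fromℤ j → i ≡ j
  fromℤ-injective i j eq = ℤₚ.i-j≡0⇒i≡j i j (kernel (i ℤ.- j) (begin
    fromℤ (i ℤ.- j)            ≈⟨ fromℤ-+ i (ℤ.- j) ⟩
    fromℤ i + fromℤ (ℤ.- j)    ≈⟨ +-cong eq (fromℤ-neg j) ⟩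
    fromℤ j - fromℤ j          ≈⟨ -‿inverseʳ _ ⟩
    0#                         ∎))
    where
    suc≉0 : ∀ m → ¬ (suc m · 1# ≈ 0#)
    suc≉0 m eq = 1≉0 (trans (sym (*-identityʳ 1#)) (unit-cancel (unit-suc m) (trans (*-congʳ eq) (zeroˡ _))))
    kernel : ∀ k → fromℤ k ≈ 0# → k ≡ + 0
    kernel (+ zero)  _  = ≡.refl
    kernel (+ suc m) eq = contradiction eq (suc≉0 m)
    kernel -[1+ m ]  eq = contradiction (trans (sym (⁻¹-involutive _)) (trans (-‿cong eq) ε⁻¹≈ε)) (suc≉0 m)

  unit-fromℤ : ∀ i → i ≢ + 0 → Unit (fromℤ i)
  unit-fromℤ (+ zero)  i≢0 = contradiction ≡.refl i≢0
  unit-fromℤ (+ suc m) i≢0 = unit-suc m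
  unit-fromℤ -[1+ m ]  i≢0 with unit-suc m
  ... | y , eq = - y , trans (solve 2 (λ x y → (:- x) :* (:- y) := x :* y) refl (suc m · 1#) y) eq

  1^n≈1 : ∀ n → 1# ^ n ≈ 1#
  1^n≈1 zero    = refl
  1^n≈1 (suc n) = trans (*-identityˡ _) (1^n≈1 n)

  -- Integral polynomials and their division

  IsInt : Carrier → Set ℓ₁
  IsInt x = ∃[ i ] x ≈ fromℤ i

  isInt-resp-≈ : ∀ {x y} → x ≈ y → IsInt x → IsInt y
  isInt-resp-≈ x≈y (i , x≈i) = i , trans (sym x≈y) x≈i

  isInt-0 : IsInt 0#
  isInt-0 = + 0 , refl

  isInt-1 : IsInt 1#
  isInt-1 = + 1 , sym fromℤ-1

  isInt-+ : ∀ {x y} → IsInt x → IsInt y → IsInt (x + y)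
  isInt-+ (i , x≈i) (j , y≈j) = i ℤ.+ j , trans (+-cong x≈i y≈j) (sym (fromℤ-+ i j))

  isInt-* : ∀ {x y} → IsInt x → IsInt y → IsInt (x * y)
  isInt-* (i , x≈i) (j , y≈j) = i ℤ.* j , trans (*-cong x≈i y≈j) (sym (fromℤ-* i j))

  isInt-neg : ∀ {x} → IsInt x → IsInt (- x)
  isInt-neg (i , x≈i) = ℤ.- i , trans (-‿cong x≈i) (sym (fromℤ-neg i))

  Integral : Poly → Set ℓ₁
  Integral p = ∀ i → IsInt (coeff p i)

  -- The inverse is required to be an integer because it is what a division multiplies by. If x is
  -- an integer as well, it is 1 or -1.
  IntegralUnit : Carrier → Set (a ⊔ ℓ₁)
  IntegralUnit x = ∃[ y ] IsInt y × x * y ≈ 1#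

  integral-+ᵖ : ∀ p q → Integral p → Integral q → Integral (p +ᵖ q)
  integral-+ᵖ p q ip iq i = isInt-resp-≈ (sym (coeff-+ᵖ p q i)) (isInt-+ (ip i) (iq i))

  integral-∷ : ∀ {c p} → IsInt c → Integral p → Integral (c ∷ p)
  integral-∷ ic ip zero    = ic
  integral-∷ ic ip (suc i) = ip i

  integral-map* : ∀ {c} p → IsInt c → Integral p → Integral (map (c *_) p)
  integral-map* {c} p ic ip i = isInt-resp-≈ (sym (coeff-map* c p i)) (isInt-* ic (ip i))

  integral-*ᵖ : ∀ p q → Integral p → Integral q → Integral (p *ᵖ q)
  integral-*ᵖ []      q ip iq = ip
  integral-*ᵖ (c ∷ p) q ip iq = integral-+ᵖ (map (c *_) q) _ (integral-map* q (ip 0) iq)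
    (integral-∷ isInt-0 (integral-*ᵖ p q (ip ∘ suc) iq))

  integral-monomial : ∀ n → Integral (monomial n)
  integral-monomial n i with i ℕₚ.≟ n
  ... | yes ≡.refl = isInt-resp-≈ (sym (coeff-monomial-≡ n)) isInt-1
  ... | no  i≢n    = isInt-resp-≈ (sym (coeff-monomial-≢ n i i≢n)) isInt-0

  integral-[1] : Integral [ 1# ]
  integral-[1] = integral-∷ isInt-1 λ _ → isInt-0

  integral-resp-≋ : ∀ p q → p ≋ q → Integral p → Integral q
  integral-resp-≋ p q p≋q ip i = isInt-resp-≈ (p≋q i) (ip i)

  integral-eval : ∀ p {x} → Integral p → IsInt x → IsInt (eval p x)
  integral-eval []      ip ix = isInt-0
  integral-eval (c ∷ p) ip ix = isInt-+ (ip 0) (isInt-* ix (integral-eval p (ip ∘ suc) ix))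

  coeff-*ᵖ-0 : ∀ p q → coeff (p *ᵖ q) 0 ≈ coeff p 0 * coeff q 0
  coeff-*ᵖ-0 []      q = sym (zeroˡ _)
  coeff-*ᵖ-0 (c ∷ p) q = begin
    coeff (map (c *_) q +ᵖ (0# ∷ p *ᵖ q)) 0  ≈⟨ coeff-+ᵖ (map (c *_) q) _ 0 ⟩
    coeff (map (c *_) q) 0 + 0#              ≈⟨ +-identityʳ _ ⟩
    coeff (map (c *_) q) 0                   ≈⟨ coeff-map* c q 0 ⟩
    c * coeff q 0                            ∎

  -- Integrality passes to quotients: the coefficients are determined successively
  -- from the constant term upwards.
  integral-/ : ∀ p q → Integral q → IntegralUnit (coeff q 0) → Integral (p *ᵖ q) → Integral p
  integral-/ []      q iq u ipq i = isInt-0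
  integral-/ (c ∷ p) q iq u@(w , iw , q₀w≈1) ipq = integral-∷ ic
    (integral-/ p q iq u λ i → isInt-resp-≈ (begin
      coeff (map (c *_) q +ᵖ (0# ∷ p *ᵖ q)) (suc i) - c * coeff q (suc i)
        ≈⟨ +-congʳ (trans (coeff-+ᵖ (map (c *_) q) _ (suc i)) (+-congʳ (coeff-map* c q (suc i)))) ⟩
      (c * coeff q (suc i) + coeff (p *ᵖ q) i) - c * coeff q (suc i)
        ≈⟨ solve 2 (λ x y → (x :+ y) :- x := y) refl (c * coeff q (suc i)) (coeff (p *ᵖ q) i) ⟩
      coeff (p *ᵖ q) i ∎)
      (isInt-+ (ipq (suc i)) (isInt-neg (isInt-* ic (iq (suc i))))))
    where
    ic : IsInt c
    ic = isInt-resp-≈ (begin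
      coeff ((c ∷ p) *ᵖ q) 0 * w    ≈⟨ *-congʳ (coeff-*ᵖ-0 (c ∷ p) q) ⟩
      (c * coeff q 0) * w           ≈⟨ *-assoc c _ w ⟩
      c * (coeff q 0 * w)           ≈⟨ *-congˡ q₀w≈1 ⟩
      c * 1#                        ≈⟨ *-identityʳ c ⟩
      c                             ∎) (isInt-* (ipq 0) iw)

  -- Integrality alone does not pass to quotients. Together with an integral inverse of the constant
  -- term it is preserved by products and by division, as the induction over the divisors of n
  -- requires.
  record Unital (p : Poly) : Set (a ⊔ ℓ₁) where
    constructor _,_
    field
      integral : Integral p
      constant : IntegralUnit (coeff p 0)

  open Unital

  unital-resp-≋ : ∀ p q → p ≋ q → Unital p → Unital q
  unital-resp-≋ p q p≋q (ip , (w , iw , p₀w≈1)) =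
    integral-resp-≋ p q p≋q ip , (w , iw , trans (*-congʳ (sym (p≋q 0))) p₀w≈1)

  unital-[1] : Unital [ 1# ]
  unital-[1] = integral-[1] , (1# , isInt-1 , *-identityˡ 1#)

  unital-*ᵖ : ∀ p q → Unital p → Unital q → Unital (p *ᵖ q)
  unital-*ᵖ p q (ip , (v , iv , p₀v≈1)) (iq , (w , iw , q₀w≈1)) =
    integral-*ᵖ p q ip iq , (v * w , isInt-* iv iw , (begin
      coeff (p *ᵖ q) 0 * (v * w)              ≈⟨ *-congʳ (coeff-*ᵖ-0 p q) ⟩
      (coeff p 0 * coeff q 0) * (v * w)
        ≈⟨ solve 4 (λ p q v w → (p :* q) :* (v :* w) := (p :* v) :* (q :* w)) refl (coeff p 0) (coeff q 0) v w ⟩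
      (coeff p 0 * v) * (coeff q 0 * w)       ≈⟨ *-cong p₀v≈1 q₀w≈1 ⟩
      1# * 1#                                 ≈⟨ *-identityˡ 1# ⟩
      1#                                      ∎))

  unital-/ : ∀ p q → Unital q → Unital (p *ᵖ q) → Unital p
  unital-/ p q (iq , uq) (ipq , (w , iw , pq₀w≈1)) =
    integral-/ p q iq uq ipq , (coeff q 0 * w , isInt-* (iq 0) iw , (begin
      coeff p 0 * (coeff q 0 * w)   ≈⟨ *-assoc _ _ w ⟨
      (coeff p 0 * coeff q 0) * w   ≈⟨ *-congʳ (coeff-*ᵖ-0 p q) ⟨
      coeff (p *ᵖ q) 0 * w          ≈⟨ pq₀w≈1 ⟩
      1#                            ∎))

  Xⁿ-1 : ℕ → Poly
  Xⁿ-1 n = [ - 1# ] +ᵖ monomial n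

  eval-Xⁿ-1 : ∀ n x → eval (Xⁿ-1 n) x ≈ x ^ n - 1#
  eval-Xⁿ-1 n x = begin
    eval (Xⁿ-1 n) x                          ≈⟨ eval-+ᵖ [ - 1# ] (monomial n) x ⟩
    (- 1# + x * 0#) + eval (monomial n) x   ≈⟨ +-congˡ (eval-monomial n x) ⟩
    (- 1# + x * 0#) + x ^ n
      ≈⟨ solve 2 (λ x y → (:- con (+ 1) :+ x :* con (+ 0)) :+ y := y :- con (+ 1)) refl x (x ^ n) ⟩
    x ^ n - 1#                              ∎

  unital-Xⁿ-1 : ∀ n → .{{NonZero n}} → Unital (Xⁿ-1 n)
  unital-Xⁿ-1 n@(suc _) =
    integral-+ᵖ [ - 1# ] (monomial n) (integral-∷ (isInt-neg isInt-1) λ _ → isInt-0) (integral-monomial n)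
    , (- 1# , isInt-neg isInt-1 , solve 0 ((:- con (+ 1) :+ con (+ 0)) :* :- con (+ 1) := con (+ 1)) refl)

  -- Products over exponents of a root of unity

  cyc : Carrier → List ℕ → Poly
  cyc ζ ks = ∏ᵖ (map (λ k → X- (ζ ^ k)) ks)

  eval-cyc : ∀ ζ k ks x → eval (cyc ζ (k ∷ ks)) x ≈ (x - ζ ^ k) * eval (cyc ζ ks) x
  eval-cyc ζ k ks x = trans (eval-*ᵖ (X- (ζ ^ k)) (cyc ζ ks) x) (*-congʳ (eval-X- (ζ ^ k) x))

  eval-1 : ∀ x → eval [ 1# ] x ≈ 1#
  eval-1 x = trans (+-congˡ (zeroʳ x)) (+-identityʳ 1#)

  eval-cyc≈∏ : ∀ ζ ks x → eval (cyc ζ ks) x ≈ ∏[x- map (ζ ^_) ks ] x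
  eval-cyc≈∏ ζ []       x = eval-1 x
  eval-cyc≈∏ ζ (k ∷ ks) x = trans (eval-cyc ζ k ks x) (*-congˡ (eval-cyc≈∏ ζ ks x))

  eval-cyc-↭ : ∀ ζ {ks ls} → ks ↭ ls → ∀ x → eval (cyc ζ ks) x ≈ eval (cyc ζ ls) x
  eval-cyc-↭ ζ Perm.refl            x = refl
  eval-cyc-↭ ζ {k ∷ ks} {_ ∷ ls} (Perm.prep k r) x = begin
    eval (cyc ζ (k ∷ ks)) x          ≈⟨ eval-cyc ζ k ks x ⟩
    (x - ζ ^ k) * eval (cyc ζ ks) x  ≈⟨ *-congˡ (eval-cyc-↭ ζ r x) ⟩
    (x - ζ ^ k) * eval (cyc ζ ls) x  ≈⟨ eval-cyc ζ k ls x ⟨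
    eval (cyc ζ (k ∷ ls)) x          ∎
  eval-cyc-↭ ζ {k ∷ l ∷ ks} {_ ∷ _ ∷ ls} (Perm.swap k l r) x = begin
    eval (cyc ζ (k ∷ l ∷ ks)) x                          ≈⟨ eval-cyc ζ k (l ∷ ks) x ⟩
    (x - ζ ^ k) * eval (cyc ζ (l ∷ ks)) x                ≈⟨ *-congˡ (eval-cyc ζ l ks x) ⟩
    (x - ζ ^ k) * ((x - ζ ^ l) * eval (cyc ζ ks) x)      ≈⟨ *-congˡ (*-congˡ (eval-cyc-↭ ζ r x)) ⟩
    (x - ζ ^ k) * ((x - ζ ^ l) * eval (cyc ζ ls) x)
      ≈⟨ solve 3 (λ a b c → a :* (b :* c) := b :* (a :* c)) refl (x - ζ ^ k) (x - ζ ^ l) (eval (cyc ζ ls) x) ⟩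
    (x - ζ ^ l) * ((x - ζ ^ k) * eval (cyc ζ ls) x)      ≈⟨ *-congˡ (eval-cyc ζ k ls x) ⟨
    (x - ζ ^ l) * eval (cyc ζ (k ∷ ls)) x                ≈⟨ eval-cyc ζ l (k ∷ ls) x ⟨
    eval (cyc ζ (l ∷ k ∷ ls)) x                          ∎
  eval-cyc-↭ ζ (Perm.trans r s)     x = trans (eval-cyc-↭ ζ r x) (eval-cyc-↭ ζ s x)

  eval-cyc-map* : ∀ ζ g ks x → eval (cyc ζ (map (g ℕ.*_) ks)) x ≈ eval (cyc (ζ ^ g) ks) x
  eval-cyc-map* ζ g []       x = refl
  eval-cyc-map* ζ g (k ∷ ks) x = begin
    eval (cyc ζ (map (g ℕ.*_) (k ∷ ks))) x                    ≈⟨ eval-cyc ζ (g ℕ.* k) (map (g ℕ.*_) ks) x ⟩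
    (x - ζ ^ (g ℕ.* k)) * eval (cyc ζ (map (g ℕ.*_) ks)) x
      ≈⟨ *-cong (+-congˡ (-‿cong (sym (^-assocʳ ζ g k)))) (eval-cyc-map* ζ g ks x) ⟩
    (x - (ζ ^ g) ^ k) * eval (cyc (ζ ^ g) ks) x               ≈⟨ eval-cyc (ζ ^ g) k ks x ⟨
    eval (cyc (ζ ^ g) (k ∷ ks)) x                             ∎

  eval-cyc-partition : ∀ ζ {p} {P : Pred ℕ p} (P? : Decidable P) ks x →
                       eval (cyc ζ ks) x ≈ eval (cyc ζ (filter P? ks)) x * eval (cyc ζ (filter (¬? ∘ P?) ks)) x
  eval-cyc-partition ζ P? []       x = solve 1 (λ x → con (+ 1) :+ x :* con (+ 0) :=
    (con (+ 1) :+ x :* con (+ 0)) :* (con (+ 1) :+ x :* con (+ 0))) refl x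
  eval-cyc-partition ζ P? (k ∷ ks) x with P? k
  ... | yes _ = begin
    eval (cyc ζ (k ∷ ks)) x             ≈⟨ eval-cyc ζ k ks x ⟩
    (x - ζ ^ k) * eval (cyc ζ ks) x     ≈⟨ *-congˡ (eval-cyc-partition ζ P? ks x) ⟩
    (x - ζ ^ k) * (A * B)               ≈⟨ *-assoc _ A B ⟨
    ((x - ζ ^ k) * A) * B               ≈⟨ *-congʳ (eval-cyc ζ k (filter P? ks) x) ⟨
    eval (cyc ζ (k ∷ filter P? ks)) x * B ∎
    where
    A = eval (cyc ζ (filter P? ks)) x
    B = eval (cyc ζ (filter (¬? ∘ P?) ks)) x
  ... | no _  = begin
    eval (cyc ζ (k ∷ ks)) x             ≈⟨ eval-cyc ζ k ks x ⟩
    (x - ζ ^ k) * eval (cyc ζ ks) x     ≈⟨ *-congˡ (eval-cyc-partition ζ P? ks x) ⟩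
    (x - ζ ^ k) * (A * B)               ≈⟨ solve 3 (λ a b c → a :* (b :* c) := b :* (a :* c)) refl (x - ζ ^ k) A B ⟩
    A * ((x - ζ ^ k) * B)               ≈⟨ *-congˡ (eval-cyc ζ k (filter (¬? ∘ P?) ks) x) ⟨
    A * eval (cyc ζ (k ∷ filter (¬? ∘ P?) ks)) x ∎
    where
    A = eval (cyc ζ (filter P? ks)) x
    B = eval (cyc ζ (filter (¬? ∘ P?) ks)) x

  -- Primitive roots and the factorisation of Xⁿ - 1

  Primitive : ℕ → Carrier → Set (a ⊔ ℓ₁)
  Primitive n ζ = ζ ^ n ≈ 1# × (∀ k → 1 ≤ k → k < n → Unit (ζ ^ k - 1#))

  primitive-^ : ∀ {ζ} g n → .{{NonZero g}} → Primitive (g ℕ.* n) ζ → Primitive n (ζ ^ g)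
  primitive-^ {ζ} g n (ζ^gn≈1 , units) =
    trans (^-assocʳ ζ g n) ζ^gn≈1
    , λ k 1≤k k<n → unit-resp-≈ (+-congʳ (sym (^-assocʳ ζ g k)))
        (units (g ℕ.* k) (ℕₚ.*-mono-≤ (ℕ.>-nonZero⁻¹ g) 1≤k) (ℕₚ.*-monoʳ-< g k<n))

  primitive-unit : ∀ {ζ} n → .{{NonZero n}} → Primitive n ζ → Unit ζ
  primitive-unit {ζ} (suc n) (ζζ^n≈1 , _) = ζ ^ n , ζζ^n≈1

  -- The powers ζ, ..., ζ^n are roots of Xⁿ - 1, and their differences ζ^j - ζ^i = ζ^i (ζ^(j-i) - 1)
  -- are products of units. Thus a monic polynomial of degree n has n separated roots, and
  -- `factorisation` applies.
  cyc-range : ∀ ζ n → .{{NonZero n}} → Primitive n ζ → ∀ x → eval (cyc ζ (range n)) x ≈ x ^ n - 1#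
  cyc-range ζ n@(suc m) prim@(ζ^n≈1 , units) x = begin
    eval (cyc ζ (range n)) x         ≈⟨ eval-cyc≈∏ ζ (range n) x ⟩
    ∏[x- roots ] x                   ≈⟨ *-identityˡ _ ⟨
    1# * ∏[x- roots ] x              ≈⟨ *-congʳ leading≈1 ⟨
    coeff (Xⁿ-1 n) (length roots) * ∏[x- roots ] x ≈⟨ factorisation (Xⁿ-1 n) roots |Xⁿ-1| separated vanishing x ⟨
    eval (Xⁿ-1 n) x                   ≈⟨ eval-Xⁿ-1 n x ⟩
    x ^ n - 1#                       ∎
    where
    roots = map (ζ ^_) (range n)
    |roots| : length roots ≡ n
    |roots| = ≡.trans (Listₚ.length-map (ζ ^_) (range n)) (≡.trans (Listₚ.length-map suc (upTo n)) (Listₚ.length-upTo n))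
    -- Adding `[ - 1# ]` affects only the constant term, so for n = m + 1 the entry at n is the
    -- entry of `monomial m` at m.
    leading≈1 : coeff (Xⁿ-1 n) (length roots) ≈ 1#
    leading≈1 = trans (reflexive (≡.cong (coeff (Xⁿ-1 n)) |roots|)) (coeff-monomial-≡ m)
    |Xⁿ-1| : length (Xⁿ-1 n) ≡ suc (length roots)
    |Xⁿ-1| = ≡.cong suc (≡.trans (Listₚ.length-++ (replicate m 0#)) (≡.trans (≡.cong (ℕ._+ 1) (Listₚ.length-replicate m))
                (≡.trans (ℕₚ.+-comm m 1) (≡.sym |roots|))))
    -- The indices i < j < n stand for the exponents i + 1 and j + 1, whose difference j - i lies
    -- strictly between 0 and n.
    separated : Separated roots
    separated = AllPairsₚ.map⁺ (AllPairsₚ.map⁺ (AllPairsₚ.applyUpTo⁺₁ id n λ {i} {j} i<j j<n → unit-resp-≈ (begin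
      ζ ^ suc i * (ζ ^ (j ℕ.∸ i) - 1#)
        ≈⟨ solve 2 (λ x y → x :* (y :- con (+ 1)) := x :* y :- x) refl (ζ ^ suc i) (ζ ^ (j ℕ.∸ i)) ⟩
      ζ ^ suc i * ζ ^ (j ℕ.∸ i) - ζ ^ suc i        ≈⟨ +-congʳ (^-homo-* ζ (suc i) (j ℕ.∸ i)) ⟨
      ζ ^ (suc i ℕ.+ (j ℕ.∸ i)) - ζ ^ suc i        ≡⟨ ≡.cong (λ k → ζ ^ suc k - ζ ^ suc i) (ℕₚ.m+[n∸m]≡n (ℕₚ.<⇒≤ i<j)) ⟩
      ζ ^ suc j - ζ ^ suc i                        ∎)
      (unit-* (unit-^ (primitive-unit n prim) (suc i))
              (units (j ℕ.∸ i) (ℕₚ.m<n⇒0<n∸m i<j) (ℕₚ.≤-<-trans (ℕₚ.m∸n≤m j i) j<n)))))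
    vanishing : Vanishing (Xⁿ-1 n) roots
    vanishing = Allₚ.map⁺ (All.universal (λ k → begin
      eval (Xⁿ-1 n) (ζ ^ k)       ≈⟨ eval-Xⁿ-1 n (ζ ^ k) ⟩
      (ζ ^ k) ^ n - 1#           ≈⟨ +-congʳ (^-assocʳ ζ k n) ⟩
      ζ ^ (k ℕ.* n) - 1#         ≡⟨ ≡.cong (λ i → ζ ^ i - 1#) (ℕₚ.*-comm k n) ⟩
      ζ ^ (n ℕ.* k) - 1#         ≈⟨ +-congʳ (^-assocʳ ζ n k) ⟨
      (ζ ^ n) ^ k - 1#           ≈⟨ +-congʳ (trans (^-congˡ k ζ^n≈1) (1^n≈1 k)) ⟩
      1# - 1#                    ≈⟨ -‿inverseʳ 1# ⟩
      0#                         ∎) (range n))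

  -- Integrality of cyclotomic polynomials

  -- The root is quantified inside the induction because the exponents with gcd(k, n) = g yield the
  -- polynomial of order n / g for ζ^g instead of ζ. All exponents with gcd(k, n) > 1 are gathered
  -- in one product, so a single division isolates Φₙ.
  cyclotomic-unital : ∀ n → .{{NonZero n}} → ∀ ζ → Primitive n ζ → Unital (cyclotomic n ζ)
  cyclotomic-unital = <-rec _ step
    where
    step : ∀ n → (∀ {k} → k < n → .{{NonZero k}} → ∀ ζ → Primitive k ζ → Unital (cyclotomic k ζ)) →
           .{{NonZero n}} → ∀ ζ → Primitive n ζ → Unital (cyclotomic n ζ)
    step n rec ζ prim = unital-/ (cyclotomic n ζ) (cyc ζ (above 1)) (above-unital 1 (n ℕ.∸ 1) (ℕₚ.m+[n∸m]≡n (ℕ.>-nonZero⁻¹ n)))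
      (unital-resp-≋ (Xⁿ-1 n) _ (≗₂⇒≋ (Xⁿ-1 n) (cyclotomic n ζ *ᵖ cyc ζ (above 1)) λ m → let x = suc (suc m) · 1# in begin
        eval (Xⁿ-1 n) x                                       ≈⟨ eval-Xⁿ-1 n x ⟩
        x ^ n - 1#                                            ≈⟨ cyc-range ζ n prim x ⟨
        eval (cyc ζ (range n)) x                              ≈⟨ eval-cyc-partition ζ (coprime? n) (range n) x ⟩
        eval (cyclotomic n ζ) x * eval (cyc ζ (filter (¬? ∘ coprime? n) (range n))) x
          -- As n is nonzero, gcd(k, n) is at least 1, so not being coprime means gcd(k, n) > 1.
          ≡⟨ ≡.cong (λ ks → eval (cyclotomic n ζ) x * eval (cyc ζ ks) x) (Listₚ.filter-≐ (¬? ∘ coprime? n) (above? 1)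
               ((λ {k} gcd≢1 → ℕₚ.≤∧≢⇒< (ℕₚ.n≢0⇒n>0 (gcd≢0 k)) (gcd≢1 ∘ ≡.sym)) , (λ 1<gcd gcd≡1 → ℕₚ.<⇒≢ 1<gcd (≡.sym gcd≡1))) (range n)) ⟩
        eval (cyclotomic n ζ) x * eval (cyc ζ (above 1)) x    ≈⟨ eval-*ᵖ (cyclotomic n ζ) _ x ⟨
        eval (cyclotomic n ζ *ᵖ cyc ζ (above 1)) x            ∎) (unital-Xⁿ-1 n))
      where
      gcd≢0 : ∀ k → gcd k n ≢ 0
      gcd≢0 k = GCD.gcd[m,n]≢0 k n (inj₂ (ℕ.≢-nonZero⁻¹ n))
      equal? : ∀ g → Decidable (λ k → gcd k n ≡ g)
      equal? g k = gcd k n ℕₚ.≟ g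
      above? : ∀ g → Decidable (λ k → g < gcd k n)
      above? g k = g ℕₚ.<? gcd k n
      equal above : ℕ → List ℕ
      equal g = filter (equal? g) (range n)
      above g = filter (above? g) (range n)

      -- The k with gcd(k,n) = g contribute the cyclotomic polynomial of order n / g.
      equal-unital : ∀ g → 1 < g → Unital (cyc ζ (equal g))
      equal-unital g@(suc _) 1<g with g ∣? n
      ... | no g∤n rewrite Listₚ.filter-none (equal? g)
                     (All.universal (λ k gcd≡g → g∤n (≡.subst (_∣ n) gcd≡g (GCD.gcd[m,n]∣n k n))) (range n)) = unital-[1]
      ... | yes (divides zero n≡0) = contradiction n≡0 (ℕ.≢-nonZero⁻¹ n)
      ... | yes (divides q@(suc _) n≡q*g) with ≡.trans n≡q*g (ℕₚ.*-comm q g)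
      ...   | ≡.refl = unital-resp-≋ (cyclotomic q (ζ ^ g)) (cyc ζ (equal g))
        (≗₂⇒≋ (cyclotomic q (ζ ^ g)) (cyc ζ (equal g)) λ m → let x = suc (suc m) · 1# in begin
          eval (cyclotomic q (ζ ^ g)) x               ≈⟨ eval-cyc-map* ζ g (totatives q) x ⟨
          eval (cyc ζ (map (g ℕ.*_) (totatives q))) x ≈⟨ eval-cyc-↭ ζ (filter-gcd g q) x ⟨
          eval (cyc ζ (equal g)) x                    ∎)
        (rec (≡.subst (q <_) (ℕₚ.*-comm q g) (ℕₚ.m<m*n q g 1<g)) (ζ ^ g) (primitive-^ g q prim))

      -- Recursion on i = n - g. No gcd exceeds n, so the product for g = n is empty; otherwise gcd
      -- > g splits into gcd = g + 1 and gcd > g + 1.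
      above-unital : ∀ g i → g ℕ.+ i ≡ n → .{{NonZero g}} → Unital (cyc ζ (above g))
      above-unital g zero eq rewrite Listₚ.filter-none (above? g)
        (All.universal (λ k g<gcd → ℕₚ.<⇒≱ g<gcd (≡.subst (gcd k n ≤_) (≡.trans (≡.sym eq) (ℕₚ.+-identityʳ g)) (GCD.gcd[m,n]≤n k n))) (range n)) = unital-[1]
      above-unital g (suc i) eq = unital-resp-≋ (cyc ζ (equal (suc g)) *ᵖ cyc ζ (above (suc g))) (cyc ζ (above g))
        (≗₂⇒≋ (cyc ζ (equal (suc g)) *ᵖ cyc ζ (above (suc g))) (cyc ζ (above g)) λ m → let x = suc (suc m) · 1# in begin
          eval (cyc ζ (equal (suc g)) *ᵖ cyc ζ (above (suc g))) x           ≈⟨ eval-*ᵖ (cyc ζ (equal (suc g))) _ x ⟩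
          eval (cyc ζ (equal (suc g))) x * eval (cyc ζ (above (suc g))) x
            ≡⟨ ≡.cong₂ (λ ks ls → eval (cyc ζ ks) x * eval (cyc ζ ls) x)
                 (filter-filter (equal? (suc g)) (above? g) (equal? (suc g))
                   (λ gcd≡1+g → gcd≡1+g , ℕₚ.≤-reflexive (≡.sym gcd≡1+g)) (λ gcd≡1+g _ → gcd≡1+g) (range n))
                 (filter-filter (¬? ∘ equal? (suc g)) (above? g) (above? (suc g))
                   (λ 1+g<gcd → ℕₚ.<⇒≢ 1+g<gcd ∘ ≡.sym , ℕₚ.<-trans (ℕₚ.n<1+n g) 1+g<gcd)
                   (λ gcd≢1+g g<gcd → ℕₚ.≤∧≢⇒< g<gcd (gcd≢1+g ∘ ≡.sym)) (range n)) ⟨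
          eval (cyc ζ (filter (equal? (suc g)) (above g))) x * eval (cyc ζ (filter (¬? ∘ equal? (suc g)) (above g))) x
            ≈⟨ eval-cyc-partition ζ (equal? (suc g)) (above g) x ⟨
          eval (cyc ζ (above g)) x                                          ∎)
        (unital-*ᵖ (cyc ζ (equal (suc g))) (cyc ζ (above (suc g)))
          (equal-unital (suc g) (s≤s (ℕ.>-nonZero⁻¹ g)))
          (above-unital (suc g) i (≡.trans (≡.sym (ℕₚ.+-suc g i)) eq)))

  -- Geometric sums and the value at 1

  -- This is 1 + Y + ⋯ + Y^(g-1) for Y = Xⁿ, in Horner form.
  geometric : ℕ → ℕ → Poly
  geometric n zero    = []
  geometric n (suc g) = [ 1# ] +ᵖ monomial n *ᵖ geometric n g

  eval-geometric-suc : ∀ n g x → eval (geometric n (suc g)) x ≈ 1# + x ^ n * eval (geometric n g) x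
  eval-geometric-suc n g x = begin
    eval ([ 1# ] +ᵖ monomial n *ᵖ geometric n g) x          ≈⟨ eval-+ᵖ [ 1# ] (monomial n *ᵖ geometric n g) x ⟩
    eval [ 1# ] x + eval (monomial n *ᵖ geometric n g) x
      ≈⟨ +-cong (eval-1 x) (trans (eval-*ᵖ (monomial n) (geometric n g) x) (*-congʳ (eval-monomial n x))) ⟩
    1# + x ^ n * eval (geometric n g) x                     ∎

  eval-geometric : ∀ n g x → (x ^ n - 1#) * eval (geometric n g) x ≈ (x ^ n) ^ g - 1#
  eval-geometric n zero    x = trans (zeroʳ _) (sym (-‿inverseʳ 1#))
  eval-geometric n (suc g) x = begin
    (y - 1#) * eval (geometric n (suc g)) x         ≈⟨ *-congˡ (eval-geometric-suc n g x) ⟩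
    (y - 1#) * (1# + y * eval (geometric n g) x)
      ≈⟨ solve 2 (λ y z → (y :- con (+ 1)) :* (con (+ 1) :+ y :* z) := (y :- con (+ 1)) :+ y :* ((y :- con (+ 1)) :* z))
           refl y (eval (geometric n g) x) ⟩
    (y - 1#) + y * ((y - 1#) * eval (geometric n g) x)  ≈⟨ +-congˡ (*-congˡ (eval-geometric n g x)) ⟩
    (y - 1#) + y * (y ^ g - 1#)
      ≈⟨ solve 2 (λ y z → (y :- con (+ 1)) :+ y :* (z :- con (+ 1)) := y :* z :- con (+ 1)) refl y (y ^ g) ⟩
    y ^ suc g - 1#                                  ∎
    where y = x ^ n

  geometric-1 : ∀ n g → eval (geometric n g) 1# ≈ g · 1#
  geometric-1 n zero    = refl
  geometric-1 n (suc g) = trans (eval-geometric-suc n g 1#)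
    (+-congˡ (trans (*-cong (1^n≈1 n) (geometric-1 n g)) (*-identityˡ _)))

  integral-geometric : ∀ n g → Integral (geometric n g)
  integral-geometric n zero    i = isInt-0
  integral-geometric n (suc g) = integral-+ᵖ [ 1# ] (monomial n *ᵖ geometric n g) integral-[1]
    (integral-*ᵖ (monomial n) (geometric n g) (integral-monomial n) (integral-geometric n g))

  nonmultiples : ℕ → ℕ → List ℕ
  nonmultiples g n = filter (¬? ∘ (g ∣?_)) (range n)

  -- All exponents up to g n give X^(gn) - 1. The multiples of g give Xⁿ - 1, since ζ^g is primitive
  -- of order n. The remaining product is the ratio of the two, obtained by cancelling the unit x^n
  -- - 1.
  cyc-nonmultiples : ∀ ζ g n → .{{NonZero g}} → .{{NonZero n}} → Primitive (g ℕ.* n) ζ →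
                     cyc ζ (nonmultiples g (g ℕ.* n)) ≗₂ geometric n g
  cyc-nonmultiples ζ g n prim m = unit-cancelˡ (unit-^-1 m n) (begin
    (x ^ n - 1#) * eval (cyc ζ (nonmultiples g (g ℕ.* n))) x     ≈⟨ *-congʳ (cyc-range (ζ ^ g) n (primitive-^ g n prim) x) ⟨
    eval (cyc (ζ ^ g) (range n)) x * B                           ≈⟨ *-congʳ (eval-cyc-map* ζ g (range n) x) ⟨
    eval (cyc ζ (map (g ℕ.*_) (range n))) x * B                  ≈⟨ *-congʳ (eval-cyc-↭ ζ (filter-multiples g n) x) ⟨
    eval (cyc ζ (filter (g ∣?_) (range (g ℕ.* n)))) x * B        ≈⟨ eval-cyc-partition ζ (g ∣?_) (range (g ℕ.* n)) x ⟨
    eval (cyc ζ (range (g ℕ.* n))) x                             ≈⟨ cyc-range ζ (g ℕ.* n) {{ℕₚ.m*n≢0 g n}} prim x ⟩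
    x ^ (g ℕ.* n) - 1#                                           ≡⟨ ≡.cong (λ k → x ^ k - 1#) (ℕₚ.*-comm g n) ⟩
    x ^ (n ℕ.* g) - 1#                                           ≈⟨ +-congʳ (^-assocʳ x n g) ⟨
    (x ^ n) ^ g - 1#                                             ≈⟨ eval-geometric n g x ⟨
    (x ^ n - 1#) * eval (geometric n g) x                        ∎)
    where
    x = suc (suc m) · 1#
    B = eval (cyc ζ (nonmultiples g (g ℕ.* n))) x

  -- Since gcd(k, g n) = 1 excludes g ∣ k, Φ(1) divides the value g of the geometric sum at 1.
  cyclotomic-1-divides : ∀ ζ g n → .{{NonZero n}} → 1 < g → Primitive (g ℕ.* n) ζ →
                         ∃[ i ] ∃[ j ] eval (cyclotomic (g ℕ.* n) ζ) 1# ≈ fromℤ i × i ℤ.* j ≡ + g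
  cyclotomic-1-divides ζ g@(suc _) n 1<g prim = i , j , Φ₁≈i , fromℤ-injective (i ℤ.* j) (+ g) (begin
    fromℤ (i ℤ.* j)                ≈⟨ fromℤ-* i j ⟩
    fromℤ i * fromℤ j              ≈⟨ *-comm _ _ ⟩
    fromℤ j * fromℤ i              ≈⟨ *-cong R₁≈j Φ₁≈i ⟨
    eval R 1# * eval Φ 1#          ≈⟨ eval-*ᵖ R Φ 1# ⟨
    eval (R *ᵖ Φ) 1#               ≈⟨ eval-resp-≋ {R *ᵖ Φ} {geometric n g} RΦ≋geometric 1# ⟩
    eval (geometric n g) 1#        ≈⟨ geometric-1 n g ⟩
    fromℤ (+ g)                    ∎)
    where
    instance gn≢0 = ℕₚ.m*n≢0 g n
    N = g ℕ.* n
    Φ = cyclotomic N ζ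
    R = cyc ζ (filter (¬? ∘ coprime? N) (nonmultiples g N))
    g∤totative : ∀ {k} → gcd k N ≡ 1 → g ∤ k
    g∤totative {k} cop g∣k = ℕₚ.<⇒≢ 1<g
      (≡.sym (Div.∣1⇒≡1 (≡.subst (g ∣_) cop (GCD.gcd-greatest g∣k (Div.m∣m*n n)))))
    RΦ≋geometric : R *ᵖ Φ ≋ geometric n g
    RΦ≋geometric = ≗₂⇒≋ (R *ᵖ Φ) (geometric n g) λ m → let x = suc (suc m) · 1# in begin
      eval (R *ᵖ Φ) x                                    ≈⟨ eval-*ᵖ R Φ x ⟩
      eval R x * eval Φ x                                ≈⟨ *-comm _ _ ⟩
      eval Φ x * eval R x
        ≡⟨ ≡.cong (λ ks → eval (cyc ζ ks) x * eval R x) (filter-filter (coprime? N) (¬? ∘ (g ∣?_)) (coprime? N)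
             (λ cop → cop , g∤totative cop) (λ cop _ → cop) (range N)) ⟨
      eval (cyc ζ (filter (coprime? N) (nonmultiples g N))) x * eval R x
        ≈⟨ eval-cyc-partition ζ (coprime? N) (nonmultiples g N) x ⟨
      eval (cyc ζ (nonmultiples g N)) x                  ≈⟨ cyc-nonmultiples ζ g n prim m ⟩
      eval (geometric n g) x                             ∎
    unital-Φ = cyclotomic-unital N ζ prim
    -- `R` is the quotient of the geometric sum by `Φ`. Both are integral and the constant term of
    -- `Φ` has an integral inverse, so `R` takes an integer value at 1.
    integral-R : Integral R
    integral-R = integral-/ R Φ (integral unital-Φ) (constant unital-Φ)
      (integral-resp-≋ (geometric n g) (R *ᵖ Φ) (sym ∘ RΦ≋geometric) (integral-geometric n g))
    Φ₁ = integral-eval Φ (integral unital-Φ) isInt-1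
    R₁ = integral-eval R integral-R isInt-1
    i = proj₁ Φ₁
    j = proj₁ R₁
    Φ₁≈i = proj₂ Φ₁
    R₁≈j = proj₂ R₁

  -- Degree, reversal and symmetry

  -- There are no spare trailing entries. Reversing the list therefore gives the reciprocal
  -- polynomial, and the length of the list determines φ(n).
  length-cyc : ∀ ζ ks → length (cyc ζ ks) ≡ suc (length ks)
  length-cyc ζ []       = ≡.refl
  length-cyc ζ (k ∷ ks) = X-*ᵖ (cyc ζ ks) (length-cyc ζ ks)
    where
    X-*ᵖ : ∀ q → length q ≡ suc (length ks) → length ((X- (ζ ^ k)) *ᵖ q) ≡ suc (suc (length ks))
    X-*ᵖ q |q| rewrite
      length-+ᵖ (map (- (ζ ^ k) *_) q) (0# ∷ (map (1# *_) q +ᵖ [ 0# ]))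
      | length-+ᵖ (map (1# *_) q) [ 0# ]
      | Listₚ.length-map (- (ζ ^ k) *_) q
      | Listₚ.length-map (1# *_) q
      | |q|
      | ℕₚ.⊔-identityʳ (length ks) = ≡.cong suc (ℕₚ.m≤n⇒m⊔n≡n (ℕₚ.n≤1+n (length ks)))

  monic-cyc : ∀ ζ ks → coeff (cyc ζ ks) (length ks) ≈ 1#
  monic-cyc ζ []       = refl
  monic-cyc ζ (k ∷ ks) = begin
    coeff ((X- (ζ ^ k)) *ᵖ q) (suc d)                            ≈⟨ coeff-+ᵖ (map (- (ζ ^ k) *_) q) _ (suc d) ⟩
    coeff (map (- (ζ ^ k) *_) q) (suc d) + coeff (map (1# *_) q +ᵖ [ 0# ]) d
      ≈⟨ +-cong (coeff-map* (- (ζ ^ k)) q (suc d)) (coeff-+ᵖ (map (1# *_) q) [ 0# ] d) ⟩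
    - (ζ ^ k) * coeff q (suc d) + (coeff (map (1# *_) q) d + coeff [ 0# ] d)
      ≈⟨ +-cong (*-congˡ (coeff-≥length q (ℕₚ.≤-reflexive (length-cyc ζ ks))))
           (+-cong (trans (coeff-map* 1# q d) (*-congˡ (monic-cyc ζ ks))) (coeff-[0] d)) ⟩
    - (ζ ^ k) * 0# + (1# * 1# + 0#)
      ≈⟨ solve 1 (λ z → (:- z) :* con (+ 0) :+ (con (+ 1) :* con (+ 1) :+ con (+ 0)) := con (+ 1)) refl (ζ ^ k) ⟩
    1#                                                           ∎
    where
    q = cyc ζ ks
    d = length ks
    coeff-[0] : ∀ i → coeff [ 0# ] i ≈ 0#
    coeff-[0] zero    = refl
    coeff-[0] (suc i) = refl

  -- With y the inverse of x, this is the reciprocal polynomial x^d p(1/x), d = `length p` - 1.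
  -- Multiplying by x once more avoids the subtraction and includes the empty list.
  eval-reverse : ∀ p {x y} → x * y ≈ 1# → eval (reverse p) x * x ≈ x ^ length p * eval p y
  eval-reverse []      xy≈1 = trans (zeroˡ _) (sym (zeroʳ _))
  eval-reverse (c ∷ p) {x} {y} xy≈1 = begin
    eval (reverse (c ∷ p)) x * x             ≡⟨ ≡.cong (λ q → eval q x * x) (Listₚ.unfold-reverse c p) ⟩
    eval (reverse p ++ [ c ]) x * x          ≈⟨ *-congʳ (eval-++ (reverse p) [ c ] x) ⟩
    (eval (reverse p) x + x ^ length (reverse p) * (c + x * 0#)) * x
      ≡⟨ ≡.cong (λ l → (eval (reverse p) x + x ^ l * (c + x * 0#)) * x) (Listₚ.length-reverse p) ⟩
    (eval (reverse p) x + x ^ length p * (c + x * 0#)) * x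
      ≈⟨ solve 4 (λ e x z c → (e :+ z :* (c :+ x :* con (+ 0))) :* x := e :* x :+ x :* z :* c) refl
           (eval (reverse p) x) x (x ^ length p) c ⟩
    eval (reverse p) x * x + x * x ^ length p * c      ≈⟨ +-congʳ (eval-reverse p xy≈1) ⟩
    x ^ length p * eval p y + x * x ^ length p * c     ≈⟨ +-congʳ (*-congʳ (trans (*-congʳ xy≈1) (*-identityˡ _))) ⟨
    (x * y) * x ^ length p * eval p y + x * x ^ length p * c
      ≈⟨ solve 5 (λ x y z e c → (x :* y) :* z :* e :+ x :* z :* c := x :* z :* (c :+ y :* e)) refl
           x y (x ^ length p) (eval p y) c ⟩
    x * x ^ length p * (c + y * eval p y)    ∎

  module _ {ζ n} (ζ^n≈1 : ζ ^ n ≈ 1#) where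

    -- It holds factor by factor: for z = ζ^k with inverse z′ = ζ^(n-k), x (1/x - z) = 1 - x z = (0
    -- - z) (x - z′). The factors 0 - z make up the value at 0.
    eval-cyc-reflect : ∀ {x y} → x * y ≈ 1# → ∀ {ks} → All (_≤ n) ks →
                       x ^ length ks * eval (cyc ζ ks) y ≈ eval (cyc ζ ks) 0# * eval (cyc ζ (map (n ℕ.∸_) ks)) x
    eval-cyc-reflect {x} {y} xy≈1 [] =
      solve 2 (λ x y → con (+ 1) :* (con (+ 1) :+ y :* con (+ 0)) :=
        (con (+ 1) :+ con (+ 0) :* con (+ 0)) :* (con (+ 1) :+ x :* con (+ 0))) refl x y
    eval-cyc-reflect {x} {y} xy≈1 {k ∷ ks} (k≤n ∷ ks≤n) = begin
      x ^ suc (length ks) * eval (cyc ζ (k ∷ ks)) y              ≈⟨ *-congˡ (eval-cyc ζ k ks y) ⟩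
      (x * x ^ length ks) * ((y - z) * eval (cyc ζ ks) y)
        ≈⟨ solve 5 (λ x l y z e → (x :* l) :* ((y :- z) :* e) := (x :* y :- x :* z) :* (l :* e)) refl
             x (x ^ length ks) y z (eval (cyc ζ ks) y) ⟩
      (x * y - x * z) * (x ^ length ks * eval (cyc ζ ks) y)      ≈⟨ *-cong (+-congʳ (trans xy≈1 (sym zz′≈1))) (eval-cyc-reflect xy≈1 ks≤n) ⟩
      (z * z′ - x * z) * (e₀ * e)
        ≈⟨ solve 5 (λ z z′ x e₀ e → (z :* z′ :- x :* z) :* (e₀ :* e) := ((con (+ 0) :- z) :* e₀) :* ((x :- z′) :* e)) refl
             z z′ x e₀ e ⟩
      ((0# - z) * e₀) * ((x - z′) * e)
        ≈⟨ *-cong (eval-cyc ζ k ks 0#) (eval-cyc ζ (n ℕ.∸ k) (map (n ℕ.∸_) ks) x) ⟨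
      eval (cyc ζ (k ∷ ks)) 0# * eval (cyc ζ (map (n ℕ.∸_) (k ∷ ks))) x ∎
      where
      z  = ζ ^ k
      z′ = ζ ^ (n ℕ.∸ k)
      e₀ = eval (cyc ζ ks) 0#
      e  = eval (cyc ζ (map (n ℕ.∸_) ks)) x
      zz′≈1 : z * z′ ≈ 1#
      zz′≈1 = begin
        ζ ^ k * ζ ^ (n ℕ.∸ k)    ≈⟨ ^-homo-* ζ k (n ℕ.∸ k) ⟨
        ζ ^ (k ℕ.+ (n ℕ.∸ k))    ≡⟨ ≡.cong (ζ ^_) (ℕₚ.m+[n∸m]≡n k≤n) ⟩
        ζ ^ n                    ≈⟨ ζ^n≈1 ⟩
        1#                       ∎

    eval-reverse-cyclotomic : 2 ≤ n → ∀ {x y} → x * y ≈ 1# →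
      eval (reverse (cyclotomic n ζ)) x ≈ eval (cyclotomic n ζ) 0# * eval (cyclotomic n ζ) x
    eval-reverse-cyclotomic 2≤n {x} {y} xy≈1 = unit-cancelˡ (y , xy≈1) (begin
      x * eval (reverse Φ) x                ≈⟨ *-comm x _ ⟩
      eval (reverse Φ) x * x                ≈⟨ eval-reverse Φ xy≈1 ⟩
      x ^ length Φ * eval Φ y               ≡⟨ ≡.cong (λ l → x ^ l * eval Φ y) (length-cyc ζ (totatives n)) ⟩
      x * x ^ φ n * eval Φ y                ≈⟨ *-assoc x _ _ ⟩
      x * (x ^ φ n * eval Φ y)              ≈⟨ *-congˡ (eval-cyc-reflect xy≈1 (All.tabulate (proj₂ ∘ proj₁ ∘ ∈-totatives⁻ n))) ⟩
      x * (eval Φ 0# * eval (cyc ζ (map (n ℕ.∸_) (totatives n))) x)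
        ≈⟨ *-congˡ (*-congˡ (eval-cyc-↭ ζ (totatives-reflect 2≤n) x)) ⟩
      x * (eval Φ 0# * eval Φ x)            ∎)
      where Φ = cyclotomic n ζ

    -- reverse Φ = Φ(0) Φ by reflection; evaluation at 1 gives Φ(0) = 1, unless Φ(1) = 0.
    cyclotomic-palindromic : 2 ≤ n → Unit (eval (cyclotomic n ζ) 1#) →
                             reverse (cyclotomic n ζ) ≋ cyclotomic n ζ
    cyclotomic-palindromic 2≤n unit = ≗₂⇒≋ (reverse Φ) Φ λ m → let x = suc (suc m) · 1# in begin
      eval (reverse Φ) x          ≈⟨ eval-reverse-cyclotomic 2≤n (proj₂ (unit-suc (suc m))) ⟩
      eval Φ 0# * eval Φ x        ≈⟨ *-congʳ Φ₀≈1 ⟩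
      1# * eval Φ x               ≈⟨ *-identityˡ _ ⟩
      eval Φ x                    ∎
      where
      Φ = cyclotomic n ζ
      1*1≈1 = *-identityˡ 1#
      Φ₀≈1 : eval Φ 0# ≈ 1#
      Φ₀≈1 = unit-cancelˡ unit (begin
        eval Φ 1# * eval Φ 0#     ≈⟨ *-comm _ _ ⟩
        eval Φ 0# * eval Φ 1#     ≈⟨ eval-reverse-cyclotomic 2≤n 1*1≈1 ⟨
        eval (reverse Φ) 1#       ≈⟨ *-identityʳ _ ⟨
        eval (reverse Φ) 1# * 1#  ≈⟨ eval-reverse Φ 1*1≈1 ⟩
        1# ^ length Φ * eval Φ 1# ≈⟨ *-congʳ (1^n≈1 (length Φ)) ⟩
        1# * eval Φ 1#            ≈⟨ *-comm _ _ ⟩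
        eval Φ 1# * 1#            ∎)

  -- Middle coefficients of integral palindromes

  integral⇒Pointwise : ∀ p → Integral p → ∃[ zs ] Pointwise _≈_ p (map fromℤ zs)
  integral⇒Pointwise []      ip = [] , []
  integral⇒Pointwise (c ∷ p) ip with ip 0 | integral⇒Pointwise p (ip ∘ suc)
  ... | z , c≈z | zs , p≈zs = z ∷ zs , c≈z ∷ p≈zs

  Pointwise⇒≋ : ∀ {p q} → Pointwise _≈_ p q → p ≋ q
  Pointwise⇒≋ []         i       = refl
  Pointwise⇒≋ (e ∷ es) zero    = e
  Pointwise⇒≋ (e ∷ es) (suc i) = Pointwise⇒≋ es i

  map-fromℤ-injective : ∀ is js → length is ≡ length js → map fromℤ is ≋ map fromℤ js → is ≡ js
  map-fromℤ-injective []       []       _   _  = ≡.refl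
  map-fromℤ-injective (i ∷ is) (j ∷ js) |≡| eq = ≡.cong₂ _∷_ (fromℤ-injective i j (eq 0))
    (map-fromℤ-injective is js (ℕₚ.suc-injective |≡|) (eq ∘ suc))

  eval-map-fromℤ-1 : ∀ zs → eval (map fromℤ zs) 1# ≈ fromℤ (sumℤ zs)
  eval-map-fromℤ-1 []       = refl
  eval-map-fromℤ-1 (z ∷ zs) =
    trans (+-congˡ (trans (*-identityˡ _) (eval-map-fromℤ-1 zs))) (sym (fromℤ-+ z (sumℤ zs)))

  coeff-map-fromℤ : ∀ is c js → coeff (map fromℤ (is ++ c ∷ js)) (length is) ≡ fromℤ c
  coeff-map-fromℤ []       c js = ≡.refl
  coeff-map-fromℤ (i ∷ is) c js = coeff-map-fromℤ is c js

  -- Parity has a meaning only in ℤ. Injectivity of `fromℤ` carries the symmetry over to the list of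
  -- integer coefficients, whose sum is the value at 1, and `palindrome-middle` applies there.
  palindromic-middle : ∀ p {i} → Integral p → reverse p ≋ p → eval p 1# ≈ fromℤ i → + 2 ∤ℤ i →
                       ∃[ h ] length p ≡ suc (h ℕ.+ h) × ∃[ c ] + 2 ∤ℤ c × coeff p h ≈ fromℤ c
  palindromic-middle p {i} ip rev p₁≈i 2∤i with integral⇒Pointwise p ip
  ... | zs , p≈zs with palindrome-middle zs reverse-zs≡zs (≡.subst (+ 2 ∤ℤ_) i≡sum 2∤i)
    where
    p≋zs = Pointwise⇒≋ p≈zs
    reverse-zs≡zs : reverse zs ≡ zs
    reverse-zs≡zs = map-fromℤ-injective (reverse zs) zs (Listₚ.length-reverse zs) λ k → begin
      coeff (map fromℤ (reverse zs)) k  ≡⟨ ≡.cong (λ q → coeff q k) (Listₚ.reverse-map fromℤ zs) ⟩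
      coeff (reverse (map fromℤ zs)) k  ≈⟨ Pointwise⇒≋ (Pointwise.reverse⁺ p≈zs) k ⟨
      coeff (reverse p) k               ≈⟨ rev k ⟩
      coeff p k                         ≈⟨ p≋zs k ⟩
      coeff (map fromℤ zs) k            ∎
    i≡sum : i ≡ sumℤ zs
    i≡sum = fromℤ-injective i (sumℤ zs) (begin
      fromℤ i                   ≈⟨ p₁≈i ⟨
      eval p 1#                 ≈⟨ eval-resp-≋ {p} {map fromℤ zs} p≋zs 1# ⟩
      eval (map fromℤ zs) 1#    ≈⟨ eval-map-fromℤ-1 zs ⟩
      fromℤ (sumℤ zs)           ∎)
  ...   | xs , c , ys , ≡.refl , |zs| , 2∤c = length xs
    , ≡.trans (Pointwise.Pointwise-length p≈zs) (≡.trans (Listₚ.length-map fromℤ (xs ++ c ∷ ys)) |zs|)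
    , c , 2∤c , trans (Pointwise⇒≋ p≈zs (length xs)) (reflexive (coeff-map-fromℤ xs c ys))

  fromIsPrimitiveRoot : ∀ {n ζ} → IsPrimitiveRoot n ζ → Primitive n ζ
  fromIsPrimitiveRoot (ζ^n≈1 , apart) = ζ^n≈1 , λ k 1≤k k<n → #⇒unit (apart k 1≤k k<n)

  middle-of-double : ∀ n ζ h → φ n ≡ h ℕ.+ h →
                     2 ∣ φ n × middleCoefficient n ζ ≈ coeff (cyclotomic n ζ) h
  middle-of-double n ζ h φ≡2h = divides h φ≡h*2
    , reflexive (≡.cong (coeff (cyclotomic n ζ)) (≡.trans (≡.cong (ℕ._/ 2) φ≡h*2) (DivMod.m*n/n≡m h 2)))
    where
    φ≡h*2 : φ n ≡ h ℕ.* 2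
    φ≡h*2 = ≡.trans φ≡2h (≡.trans (≡.cong (h ℕ.+_) (≡.sym (ℕₚ.+-identityʳ h))) (ℕₚ.*-comm 2 h))

  -- Oddness of Φₙ(1) serves twice: it makes the value nonzero, hence a unit, which gives the
  -- symmetry, and it supplies the parity of the coefficient sum.
  middle-odd : ∀ n ζ i → .{{NonZero n}} → 2 ≤ n → Primitive n ζ → eval (cyclotomic n ζ) 1# ≈ fromℤ i → + 2 ∤ℤ i →
               2 ∣ φ n × ∃[ c ] OddInteger c × middleCoefficient n ζ ≈ fromℤ c
  middle-odd n ζ i 2≤n prim Φ₁≈i 2∤i =
    let h , |Φ| , c , 2∤c , Φₕ≈c = palindromic-middle (cyclotomic n ζ) {i}
          (integral (cyclotomic-unital n ζ prim)) (cyclotomic-palindromic (proj₁ prim) 2≤n unit-Φ₁) Φ₁≈i 2∤i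
        2∣φ , middle≈Φₕ = middle-of-double n ζ h
          (ℕₚ.suc-injective (≡.trans (≡.sym (length-cyc ζ (totatives n))) |Φ|))
    in 2∣φ , c , odd⁺ 2∤c , trans middle≈Φₕ Φₕ≈c
    where
    unit-Φ₁ : Unit (eval (cyclotomic n ζ) 1#)
    unit-Φ₁ = unit-resp-≈ (sym Φ₁≈i) (unit-fromℤ i λ i≡0 → 2∤i (Signed.divides (+ 0) i≡0))

  middle-odd-multiple : ∀ g n ζ → .{{NonZero n}} → 2 ∤ g → 1 < g → Primitive (g ℕ.* n) ζ →
                        2 ∣ φ (g ℕ.* n) × ∃[ c ] OddInteger c × middleCoefficient (g ℕ.* n) ζ ≈ fromℤ c
  middle-odd-multiple g n ζ 2∤g 1<g prim =
    let i , j , Φ₁≈i , ij≡g = cyclotomic-1-divides ζ g n 1<g prim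
        2≤gn = ℕₚ.*-mono-≤ 1<g (ℕ.>-nonZero⁻¹ n)
    in middle-odd (g ℕ.* n) ζ i {{ℕ.>-nonZero (ℕₚ.<⇒≤ 2≤gn)}} 2≤gn prim Φ₁≈i (∤-factor {i} {j} ij≡g 2∤g)

  -- Orders that are powers of two

  -- The totatives of 2^(a+1) are the odd numbers, that is, the nonmultiples of 2, so the geometric
  -- sum has just two terms.
  cyclotomic-2^ : ∀ ζ a → Primitive (2 ℕ.^ suc a) ζ → cyclotomic (2 ℕ.^ suc a) ζ ≋ [ 1# ] +ᵖ monomial (2 ℕ.^ a)
  cyclotomic-2^ ζ a prim = ≗₂⇒≋ (cyclotomic N ζ) ([ 1# ] +ᵖ monomial (2 ℕ.^ a)) λ m → let x = suc (suc m) · 1# in begin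
    eval (cyclotomic N ζ) x                 ≡⟨ ≡.cong (λ ks → eval (cyc ζ ks) x) (Listₚ.filter-≐ (coprime? N) (¬? ∘ (2 ∣?_))
                                                 ((λ {k} → proj₂ (odd⇔coprime-2^ k a)) , (λ {k} → proj₁ (odd⇔coprime-2^ k a))) (range N)) ⟩
    eval (cyc ζ (nonmultiples 2 N)) x       ≈⟨ cyc-nonmultiples ζ 2 (2 ℕ.^ a) {{_}} {{ℕₚ.m^n≢0 2 a}} prim m ⟩
    eval (geometric (2 ℕ.^ a) 2) x          ≈⟨ eval-geometric-suc (2 ℕ.^ a) 1 x ⟩
    1# + x ^ (2 ℕ.^ a) * eval (geometric (2 ℕ.^ a) 1) x
      ≈⟨ +-congˡ (*-congˡ (trans (eval-geometric-suc (2 ℕ.^ a) 0 x) (trans (+-congˡ (zeroʳ _)) (+-identityʳ 1#)))) ⟩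
    1# + x ^ (2 ℕ.^ a) * 1#                 ≈⟨ +-cong (sym (eval-1 x)) (trans (*-identityʳ _) (sym (eval-monomial (2 ℕ.^ a) x))) ⟩
    eval [ 1# ] x + eval (monomial (2 ℕ.^ a)) x  ≈⟨ eval-+ᵖ [ 1# ] (monomial (2 ℕ.^ a)) x ⟨
    eval ([ 1# ] +ᵖ monomial (2 ℕ.^ a)) x   ∎
    where N = 2 ℕ.^ suc a

  coeff-1+monomial : ∀ n i → 0 < i → coeff ([ 1# ] +ᵖ monomial n) i ≈ coeff (monomial n) i
  coeff-1+monomial n (suc i) _ = trans (coeff-+ᵖ [ 1# ] (monomial n) (suc i)) (+-identityˡ _)

  -- The degree is compared instead of evaluating φ arithmetically. If d > φ(n), the list of Φₙ is
  -- too short for the coefficient 1 at d; if d < φ(n), the leading coefficient 1 meets a zero of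
  -- the binomial. Positivity of d keeps clear of the constant term.
  φ-unique : ∀ n ζ d → 0 < d → cyclotomic n ζ ≋ [ 1# ] +ᵖ monomial d → φ n ≡ d
  φ-unique n ζ d 0<d Φ≋ with φ n ℕₚ.≟ d | d ℕₚ.≤? φ n
  ... | yes eq | _ = eq
  ... | no _   | no d≰φ = contradiction (begin
    1#                                       ≈⟨ coeff-monomial-≡ d ⟨
    coeff (monomial d) d                     ≈⟨ coeff-1+monomial d d 0<d ⟨
    coeff ([ 1# ] +ᵖ monomial d) d           ≈⟨ Φ≋ d ⟨
    coeff (cyclotomic n ζ) d
      ≈⟨ coeff-≥length (cyclotomic n ζ) (≡.subst (_≤ d) (≡.sym (length-cyc ζ (totatives n))) (ℕₚ.≰⇒> d≰φ)) ⟩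
    0#                                       ∎) 1≉0
  ... | no φ≢d | yes d≤φ = contradiction (begin
    1#                                       ≈⟨ monic-cyc ζ (totatives n) ⟨
    coeff (cyclotomic n ζ) (φ n)             ≈⟨ Φ≋ (φ n) ⟩
    coeff ([ 1# ] +ᵖ monomial d) (φ n)       ≈⟨ coeff-1+monomial d (φ n) (ℕₚ.<-≤-trans 0<d d≤φ) ⟩
    coeff (monomial d) (φ n)                 ≈⟨ coeff-monomial-≢ d (φ n) φ≢d ⟩
    0#                                       ∎) 1≉0

  -- The exponent h lies strictly between 0 and 2h, the only exponents that occur.
  middle-binomial : ∀ n ζ h → 0 < h → cyclotomic n ζ ≋ [ 1# ] +ᵖ monomial (h ℕ.+ h) →
                    2 ∣ φ n × middleCoefficient n ζ ≈ 0#
  middle-binomial n ζ h 0<h Φ≋ =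
    let 2∣φ , middle≈Φₕ = middle-of-double n ζ h (φ-unique n ζ (h ℕ.+ h) (ℕₚ.m≤n⇒m≤n+o h 0<h) Φ≋)
    in 2∣φ , (begin
    middleCoefficient n ζ                     ≈⟨ middle≈Φₕ ⟩
    coeff (cyclotomic n ζ) h                  ≈⟨ Φ≋ h ⟩
    coeff ([ 1# ] +ᵖ monomial (h ℕ.+ h)) h    ≈⟨ coeff-1+monomial (h ℕ.+ h) h 0<h ⟩
    coeff (monomial (h ℕ.+ h)) h              ≈⟨ coeff-monomial-≢ (h ℕ.+ h) h (ℕₚ.<⇒≢ (ℕₚ.m<m+n h 0<h)) ⟩
    0#                                        ∎)

  middle-2^ : ∀ n ζ a → n ≡ 2 ℕ.^ suc (suc a) → Primitive n ζ → 2 ∣ φ n × middleCoefficient n ζ ≈ 0#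
  middle-2^ n ζ a ≡.refl prim = middle-binomial n ζ (2 ℕ.^ a) (ℕₚ.m^n>0 2 a)
    -- The degree 2^(a+1) unfolds to 2^a + (2^a + 0) and is brought into the form h + h with h =
    -- 2^a.
    (≡.subst (λ d → cyclotomic n ζ ≋ [ 1# ] +ᵖ monomial d)
      (≡.cong (2 ℕ.^ a ℕ.+_) (ℕₚ.+-identityʳ (2 ℕ.^ a))) (cyclotomic-2^ ζ (suc a) prim))

theorem1 : ∀ {a ℓ₁ ℓ₂} (K : HeytingField a ℓ₁ ℓ₂) →
           let open HeytingField K in
           let open OverField K in
           CharacteristicZero →
           ∀ (n : ℕ) → n ≥ 3 →
           ∀ (ζ : Carrier) → IsPrimitiveRoot n ζ →
           (2 ∣ φ n) ×
           (IsPowerOf2 n → middleCoefficient n ζ ≈ 0#) ×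
           (¬ IsPowerOf2 n → ∃[ c ] (OddInteger c × middleCoefficient n ζ ≈ fromℤ c))
theorem1 K char0 n n≥3 ζ root = cases (odd-part n {{ℕ.>-nonZero (ℕₚ.≤-trans (s≤s z≤n) n≥3)}})
  where
  open HeytingField K
  open OverField K
  open CharacteristicZeroField K char0
  prim = fromIsPrimitiveRoot root

  Conclusion : ℕ → Set _
  Conclusion n = (2 ∣ φ n) ×
    (IsPowerOf2 n → middleCoefficient n ζ ≈ 0#) ×
    (¬ IsPowerOf2 n → ∃[ c ] (OddInteger c × middleCoefficient n ζ ≈ fromℤ c))

  power : ∀ a → n ≡ 2 ℕ.^ a → Conclusion n
  power 0 n≡1 = contradiction (≡.subst (3 ≤_) n≡1 n≥3) λ { (s≤s ()) }
  power 1 n≡2 = contradiction (≡.subst (3 ≤_) n≡2 n≥3) λ { (s≤s (s≤s ())) }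
  power (suc (suc a)) n≡ =
    let 2∣φ , middle≈0 = middle-2^ n ζ a n≡ prim
    in 2∣φ , (λ _ → middle≈0) , contradiction (suc (suc a) , n≡)

  non-power : ∀ m a → 2 ∤ m → 1 < m → n ≡ m ℕ.* 2 ℕ.^ a → Conclusion n
  non-power m a 2∤m 1<m n≡ =
    let 2∣φ , odd-middle = ≡.subst (λ k → 2 ∣ φ k × ∃[ c ] (OddInteger c × middleCoefficient k ζ ≈ fromℤ c)) (≡.sym n≡)
          (middle-odd-multiple m (2 ℕ.^ a) ζ {{ℕₚ.m^n≢0 2 a}} 2∤m 1<m (≡.subst (λ k → Primitive k ζ) n≡ prim))
    in 2∣φ
     -- This case is void: a power of 2 has no odd divisor m > 1.
     , (λ (k , n≡2^k) → contradiction (≡.sym (odd∣2^⇒≡1 2∤m k (divides (2 ℕ.^ a)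
         (≡.trans (≡.sym n≡2^k) (≡.trans n≡ (ℕₚ.*-comm m (2 ℕ.^ a))))))) (ℕₚ.<⇒≢ 1<m))
     , λ _ → odd-middle

  cases : (∃[ a ] ∃[ m ] n ≡ m ℕ.* 2 ℕ.^ a × 2 ∤ m) → Conclusion n
  cases (a , 0 , _ , 2∤0) = contradiction (2 Div.∣0) 2∤0
  cases (a , 1 , n≡ , _) = power a (≡.trans n≡ (ℕₚ.*-identityˡ (2 ℕ.^ a)))
  cases (a , suc (suc m) , n≡ , 2∤m) = non-power (suc (suc m)) a 2∤m (s≤s (s≤s z≤n)) n≡
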